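{- For $n\ge3$ with $n\equiv2\pmod4$ and $k\ge3$, $$p_n(\Sigma^-_k)=\sum_{i=2}^kC'(n,i)-C'(\tfrac n2,k).$$
   Context: For $\sigma\in\{+,-\}^k$ ($k\ge2$), let $\mathcal W_k$ be the set of infinite words over $\{0,\dots,k-1\}$ with the linear order $\prec_\sigma$: for $s\neq t$, with $j$ the first index where $s_j\neq t_j$ and $c=|\{i<j:\sigma_{s_i}=-\}|$, $s\prec_\sigma t$ iff ($c$ even and $s_j<t_j$) or ($c$ odd and $s_j>t_j$). The signed shift $\Sigma_\sigma$ deletes the first letter of a word. Let $\mathcal W_{k,n}$ be the set of words $(s_1\dots s_n)^\infty$ with $s_1\dots s_n$ primitive (not a power of a shorter word). For $s\in\mathcal W_{k,n}$ let $\Pi_\sigma(s)\in\mathcal S_n$ be the permutation with $\Pi_\sigma(s)_i<\Pi_\sigma(s)_j$ iff $s_is_{i+1}\dots\prec_\sigma s_js_{j+1}\dots$. Let $\mathcal P_n(\Sigma_\sigma)=\{\Pi_\sigma(s):s\in\mathcal W_{k,n}\}$ and $p_n(\Sigma_\sigma)=|\mathcal P_n(\Sigma_\sigma)|/n$ (the number of classes of $\mathcal P_n(\Sigma_\sigma)$ under cyclic rotation). $\Sigma^-_k$ denotes the reverse $k$-shift $\Sigma_{ -^k}$ (all signs $-$). $C'(n,i)$ denotes the number of cyclic permutations ($n$-cycles) in $\mathcal S_n$ with exactly $i-1$ ascents, an ascent of $\tau$ being an $i\in[n-1]$ with $\tau_i<\tau_{i+1}$. -}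

module Defs where

open import Data.Nat using (ℕ; zero; suc; _+_; _*_; _<_; _%_; _<ᵇ_)
open import Data.Nat.DivMod using (_mod_)
open import Data.Nat.Divisibility using (_∣_)
open import Data.Fin as F using (Fin; toℕ)
open import Data.Vec using (Vec; lookup; toList)
open import Data.List using (List; []; _∷_; length)
open import Data.List.Relation.Unary.Unique.Propositional using (Unique)
open import Data.List.Membership.Propositional using (_∈_)
open import Data.Bool using (if_then_else_)
open import Data.Product using (_×_; ∃-syntax)
open import Data.Sum using (_⊎_)
open import Data.Empty using (⊥)
open import Relation.Binary.PropositionalEquality using (_≡_)
open import Relation.Nullary using (¬_)
open import Function.Bundles using (_⇔_)

HasSize : {A : Set} → (A → Set) → ℕ → Set
HasSize {A} P m =
  ∃[ xs ] (Unique xs × (∀ (x : A) → (x ∈ xs ⇔ P x)) × length xs ≡ m)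

sumFrom : ℕ → ℕ → (ℕ → ℕ) → ℕ
sumFrom a zero    f = 0
sumFrom a (suc l) f = f a + sumFrom (suc a) l f

data Sign : Set where
  plus minus : Sign

Word : ℕ → Set
Word k = ℕ → Fin k

isMinus : Sign → ℕ
isMinus plus  = 0
isMinus minus = 1

countMinus : ∀ {k} → (Fin k → Sign) → Word k → ℕ → ℕ
countMinus σ s zero    = 0
countMinus σ s (suc j) = countMinus σ s j + isMinus (σ (s j))

_≺[_]_ : ∀ {k} → Word k → (Fin k → Sign) → Word k → Set
s ≺[ σ ] t = ∃[ j ] ((∀ m → m < j → s m ≡ t m) ×
   ((countMinus σ s j % 2 ≡ 0 × s j F.< t j) ⊎
    (countMinus σ s j % 2 ≡ 1 × t j F.< s j)))

shiftBy : ∀ {k} → ℕ → Word k → Word k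
shiftBy i s m = s (i + m)

periodic : ∀ {k n} → Vec (Fin k) (suc n) → Word k
periodic {n = n} s m = lookup s (m mod suc n)

Primitive : ∀ {k n} → Vec (Fin k) n → Set
Primitive {n = n} s = ∀ d → 0 < d → d < n → d ∣ n →
  ¬ (∀ (i j : Fin n) → toℕ j ≡ toℕ i + d → lookup s i ≡ lookup s j)

IsPerm : ∀ {n} → Vec (Fin n) n → Set
IsPerm π = ∀ i j → lookup π i ≡ lookup π j → i ≡ j

IsPattern : ∀ {k n} → (Fin k → Sign) → Vec (Fin k) (suc n) →
            Vec (Fin (suc n)) (suc n) → Set
IsPattern σ s π = ∀ i j →
  (lookup π i F.< lookup π j) ⇔
  (shiftBy (toℕ i) (periodic s) ≺[ σ ] shiftBy (toℕ j) (periodic s))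

InPatterns : (n k : ℕ) → (Fin k → Sign) → Vec (Fin n) n → Set
InPatterns zero    k σ π = ⊥
InPatterns (suc n) k σ π =
  IsPerm π × ∃[ s ] (Primitive {k} s × IsPattern σ s π)

allMinus : ∀ {k} → Fin k → Sign
allMinus _ = minus

iter : ∀ {n} → Vec (Fin n) n → ℕ → Fin n → Fin n
iter π zero    x = x
iter π (suc m) x = lookup π (iter π m x)

IsNCycle : ∀ {n} → Vec (Fin n) n → Set
IsNCycle π = IsPerm π × (∀ x y → ∃[ m ] (iter π m x ≡ y))

ascList : ∀ {n} → List (Fin n) → ℕ
ascList []            = 0
ascList (a ∷ [])      = 0
ascList (a ∷ b ∷ xs)  =
  (if toℕ a <ᵇ toℕ b then 1 else 0) + ascList (b ∷ xs)

ascents : ∀ {n} → Vec (Fin n) n → ℕ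
ascents π = ascList (toList π)

-- π is counted by C'(n,i): an n-cycle with exactly i-1 ascents
CycAsc : (n i : ℕ) → Vec (Fin n) n → Set
CycAsc n i π = IsNCycle π × ascents π + 1 ≡ i

{-# OPTIONS --safe #-}
module Submission where

-- Ordering the shifts of a periodic word s turns the shift into an n-cycle τ (the cycle
-- written (π₁ … πₙ) for π = Π(s)), and each π comes from exactly one pair (τ , π₁).  The
-- letters cut the ranks into at most k intervals on which τ decreases, so τ has at most
-- k − 1 ascents.  Conversely, cutting an n-cycle τ at its ascents yields a word, which
-- realises τ unless it is periodic.  With fewer than k − 1 ascents a spare cut isolates
-- rank 0, and a letter that occurs once makes the word primitive.  With exactly k − 1
-- ascents the cuts are forced.  If then x and τ ^ e x have the same word, τ ^ 2e preserves
-- the order along their orbit, hence fixes x, so 2e = n and the ranks with equal words are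
-- the pairs {2q , 2q + 1}: τ is the doubling of an (n/2)-cycle with as many ascents.  As
-- n/2 is odd, every such doubling is an n-cycle, and these are the C'(n/2 , k) exceptions.

open import Defs
open import Data.Bool using (if_then_else_; true; false)
open import Data.Nat using (ℕ; zero; suc; _+_; _*_; _∸_; _%_; _/_; _≤_; _<_; _<ᵇ_; s≤s; s≤s⁻¹; z≤n; z<s)
open import Data.Nat.Properties
open import Data.Nat.DivMod using (%-distribˡ-+; [m+n]%n≡m%n; _mod_; m%n%n≡m%n; m%n<n; m*n%n≡0; m*n/n≡m; m<n⇒m%n≡m; m∣n⇒o%n%m≡o%m; m≡m%n+[m/n]*n)
open import Data.Nat.Divisibility using (_∣_; m∣m*n)
open import Data.Fin as F using (Fin; toℕ; zero; suc; combine; remQuot; opposite; punchOut)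
open import Data.Fin.Properties as F using (combine-injective; combine-injectiveˡ; combine-remQuot; combine-surjective; injective⇒≤; opposite-involutive; pigeonhole; punchOut-injective; remQuot-combine; toℕ-combine; toℕ-fromℕ; toℕ-fromℕ<; toℕ-inject; toℕ-injective; toℕ<n; toℕ≤pred[n]; ¬∀⟶∃¬-smallest)
open import Data.Vec using (Vec; []; _∷_; lookup; tabulate; toList)
open import Data.Vec.Properties using (∷-injective; lookup∘tabulate; tabulate∘lookup; tabulate-cong; ≡-dec)
open import Data.List using (List; []; _∷_; _++_; map; length; filter; allFin; cartesianProduct; cartesianProductWith)
open import Data.List.Properties using (length-map; length-++; length-tabulate)
open import Data.List.Membership.Propositional using (_∈_)
open import Data.List.Membership.Propositional.Properties using (∈-map⁺; ∈-map⁻; ∈-++⁺ˡ; ∈-++⁺ʳ; ∈-++⁻; ∈-filter⁺; ∈-filter⁻; ∈-allFin; ∈-cartesianProduct⁺; ∈-cartesianProduct⁻; ∈-cartesianProductWith⁺)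
open import Data.List.Membership.Propositional.Properties.WithK using (unique∧set⇒bag)
open import Data.List.Relation.Binary.BagAndSetEquality using (∼bag⇒↭)
open import Data.List.Relation.Binary.Permutation.Propositional.Properties using (↭-length)
open import Data.List.Relation.Unary.Any using (here; there; any?)
open import Data.List.Relation.Unary.All as All using ([])
open import Data.List.Relation.Unary.AllPairs using ([]; _∷_)
open import Data.List.Relation.Unary.Unique.Propositional using (Unique)
open import Data.List.Relation.Unary.Unique.Propositional.Properties using (++⁺; filter⁺; allFin⁺; cartesianProduct⁺; cartesianProductWith⁺)
open import Data.Product using (_×_; _,_; proj₁; proj₂; ∃-syntax)
open import Data.Sum using (_⊎_; inj₁; inj₂)
open import Data.Unit using (⊤; tt)
open import Function.Bundles using (_⇔_; mk⇔; Equivalence)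
open import Relation.Binary.Definitions using (DecidableEquality; Transitive; Tri; tri<; tri≈; tri>)
open import Relation.Binary.PropositionalEquality using (_≡_; _≢_; refl; sym; trans; cong; cong₂; subst; subst₂; module ≡-Reasoning)
open import Relation.Nullary using (¬_; Dec; yes; no; contradiction)
open import Relation.Nullary.Decidable as Dec using (map′; _×-dec_; _→-dec_; ¬?)
open import Relation.Unary using (Decidable)
open Equivalence using (to; from)

-- Counting

HasSize-resp : {A : Set} {P Q : A → Set} {m : ℕ} →
  (∀ x → P x ⇔ Q x) → HasSize P m → HasSize Q m
HasSize-resp P⇔Q (xs , u , mem , len) =
  xs , u , (λ x → mk⇔ (λ x∈ → to (P⇔Q x) (to (mem x) x∈)) (λ q → from (mem x) (from (P⇔Q x) q))) , len

-- Duplicate-free lists with the same members are permutations of each other; this turns two ways of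
-- counting one set into an equation.
HasSize-functional : {A : Set} {P : A → Set} {m m′ : ℕ} →
  HasSize P m → HasSize P m′ → m ≡ m′
HasSize-functional (xs , u , mem , refl) (ys , v , mem′ , refl) =
  ↭-length (∼bag⇒↭ (unique∧set⇒bag u v λ {x} →
    mk⇔ (λ x∈ → from (mem′ x) (to (mem x) x∈)) (λ x∈ → from (mem x) (to (mem′ x) x∈))))

HasSize-⊥ : {A : Set} {P : A → Set} → (∀ x → ¬ P x) → HasSize P 0
HasSize-⊥ ¬P = [] , [] , (λ x → mk⇔ (λ ()) (λ p → contradiction p (¬P x))) , refl

HasSize-⊎ : {A : Set} {P Q : A → Set} {m m′ : ℕ} → (∀ x → P x → ¬ Q x) →
  HasSize P m → HasSize Q m′ → HasSize (λ x → P x ⊎ Q x) (m + m′)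
HasSize-⊎ {P = P} {Q} disj (xs , u , mem , refl) (ys , v , mem′ , refl) =
  xs ++ ys ,
  ++⁺ u v (λ {x} (x∈xs , x∈ys) → disj x (to (mem x) x∈xs) (to (mem′ x) x∈ys)) ,
  (λ x → mk⇔ (fwd x) (bwd x)) ,
  length-++ xs
  where
  fwd : ∀ x → x ∈ xs ++ ys → P x ⊎ Q x
  fwd x x∈ with ∈-++⁻ xs x∈
  ... | inj₁ p = inj₁ (to (mem x) p)
  ... | inj₂ q = inj₂ (to (mem′ x) q)
  bwd : ∀ x → P x ⊎ Q x → x ∈ xs ++ ys
  bwd x (inj₁ p) = ∈-++⁺ˡ (from (mem x) p)
  bwd x (inj₂ q) = ∈-++⁺ʳ xs (from (mem′ x) q)

-- Injectivity is asked only on members of the list, because `orbit` is shown injective only on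
-- pairs whose first component is a cycle.
map-unique-on : {A B : Set} (f : A → B) {xs : List A} →
  (∀ {x y} → x ∈ xs → y ∈ xs → f x ≡ f y → x ≡ y) → Unique xs → Unique (map f xs)
map-unique-on f inj [] = []
map-unique-on f {x ∷ xs} inj (x∉ ∷ u) =
  All.tabulate (λ y∈ fx≡y → let z , z∈ , y≡fz = ∈-map⁻ f y∈ in
    All.lookup x∉ z∈ (inj (here refl) (there z∈) (trans fx≡y y≡fz)))
  ∷ map-unique-on f (λ p q → inj (there p) (there q)) u

HasSize-image : {A B : Set} {P : A → Set} {m : ℕ} (f : A → B) →
  (∀ {x y} → P x → P y → f x ≡ f y → x ≡ y) →
  HasSize P m → HasSize (λ y → ∃[ x ] (P x × y ≡ f x)) m
HasSize-image {P = P} f inj (xs , u , mem , len) =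
  map f xs ,
  map-unique-on f (λ p q → inj (to (mem _) p) (to (mem _) q)) u ,
  (λ y → mk⇔ (λ y∈ → let x , x∈ , eq = ∈-map⁻ f y∈ in x , to (mem x) x∈ , eq)
             (λ { (x , px , refl) → ∈-map⁺ f (from (mem x) px) })) ,
  trans (length-map f xs) len

length-cartesianProduct : {A B : Set} (xs : List A) (ys : List B) →
  length (cartesianProduct xs ys) ≡ length xs * length ys
length-cartesianProduct []       ys = refl
length-cartesianProduct (x ∷ xs) ys =
  trans (length-++ (map (x ,_) ys))
    (cong₂ _+_ (length-map (x ,_) ys) (length-cartesianProduct xs ys))

HasSize-×Fin : {A : Set} {P : A → Set} {m : ℕ} (n : ℕ) →
  HasSize P m → HasSize {A × Fin n} (λ xi → P (proj₁ xi)) (m * n)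
HasSize-×Fin n (xs , u , mem , refl) =
  cartesianProduct xs (allFin n) ,
  cartesianProduct⁺ u (allFin⁺ n) ,
  (λ (x , i) → mk⇔ (λ xi∈ → to (mem x) (proj₁ (∈-cartesianProduct⁻ xs (allFin n) xi∈)))
                   (λ p → ∈-cartesianProduct⁺ (from (mem x) p) (∈-allFin i))) ,
  trans (length-cartesianProduct xs (allFin n)) (cong (length xs *_) (length-tabulate {n = n} (λ i → i)))

HasSize-dec : {A : Set} {P : A → Set} {m : ℕ} → DecidableEquality A →
  HasSize P m → Decidable P
HasSize-dec _≟_ (xs , _ , mem , _) x = Dec.map (mem x) (any? (x ≟_) xs)

-- Supplies the counts whose existence the theorem asserts, from decidability alone.
HasSize-filter : {A : Set} {P : A → Set} {m : ℕ} → HasSize {A} (λ _ → ⊤) m →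
  Decidable P → ∃[ m′ ] HasSize P m′
HasSize-filter (xs , u , mem , _) P? =
  _ , filter P? xs , filter⁺ P? u ,
  (λ x → mk⇔ (λ x∈ → proj₂ (∈-filter⁻ P? {xs = xs} x∈)) (∈-filter⁺ P? (from (mem x) tt))) , refl

allVecs : (n m : ℕ) → List (Vec (Fin n) m)
allVecs n zero    = [] ∷ []
allVecs n (suc m) = cartesianProductWith _∷_ (allFin n) (allVecs n m)

∈-allVecs : ∀ {n m} (v : Vec (Fin n) m) → v ∈ allVecs n m
∈-allVecs []      = here refl
∈-allVecs (x ∷ v) = ∈-cartesianProductWith⁺ _∷_ (∈-allFin x) (∈-allVecs v)

allVecs-unique : ∀ n m → Unique (allVecs n m)
allVecs-unique n zero    = [] ∷ []
allVecs-unique n (suc m) = cartesianProductWith⁺ _∷_ ∷-injective (allFin⁺ n) (allVecs-unique n m)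

HasSize-Vec : ∀ n m → HasSize {Vec (Fin n) m} (λ _ → ⊤) (length (allVecs n m))
HasSize-Vec n m = allVecs n m , allVecs-unique n m , (λ v → mk⇔ (λ _ → tt) (λ _ → ∈-allVecs v)) , refl

HasSize-sumFrom : {A : Set} (P : A → Set) (h : A → ℕ) (c : ℕ → ℕ) →
  (∀ i → HasSize (λ x → P x × h x ≡ i) (c i)) → ∀ a l →
  HasSize (λ x → P x × a ≤ h x × h x < a + l) (sumFrom a l c)
HasSize-sumFrom P h c sz a zero    =
  HasSize-⊥ (λ x (_ , a≤h , h<a+0) → contradiction (≤-<-trans a≤h (subst (h x <_) (+-identityʳ a) h<a+0)) (n≮n a))
HasSize-sumFrom P h c sz a (suc l) =
  HasSize-resp (λ x → mk⇔ (merge x) (split x))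
    (HasSize-⊎ (λ x (_ , h≡a) (_ , a<h , _) → <⇒≢ a<h (sym h≡a)) (sz a) (HasSize-sumFrom P h c sz (suc a) l))
  where
  merge : ∀ x → (P x × h x ≡ a) ⊎ (P x × suc a ≤ h x × h x < suc a + l) → P x × a ≤ h x × h x < a + suc l
  merge x (inj₁ (p , refl))        = p , ≤-refl , subst (h x <_) (sym (+-suc (h x) l)) (m≤m+n (suc (h x)) l)
  merge x (inj₂ (p , a<h , h<a+l)) = p , <⇒≤ a<h , subst (h x <_) (sym (+-suc a l)) h<a+l
  split : ∀ x → P x × a ≤ h x × h x < a + suc l → (P x × h x ≡ a) ⊎ (P x × suc a ≤ h x × h x < suc a + l)
  split x (p , a≤h , h<) with m≤n⇒m<n∨m≡n a≤h
  ... | inj₁ a<h = inj₂ (p , a<h , subst (h x <_) (+-suc a l) h<)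
  ... | inj₂ a≡h = inj₁ (p , sym a≡h)

-- Iterating a cycle

iter-+ : ∀ {n} (τ : Vec (Fin n) n) a b x → iter τ (a + b) x ≡ iter τ a (iter τ b x)
iter-+ τ zero    b x = refl
iter-+ τ (suc a) b x = cong (lookup τ) (iter-+ τ a b x)

iter-comm : ∀ {n} (τ : Vec (Fin n) n) a b x → iter τ a (iter τ b x) ≡ iter τ b (iter τ a x)
iter-comm τ a b x = trans (sym (iter-+ τ a b x)) (trans (cong (λ m → iter τ m x) (+-comm a b)) (iter-+ τ b a x))

iter-injective : ∀ {n} {τ : Vec (Fin n) n} → IsPerm τ → ∀ m {x y} → iter τ m x ≡ iter τ m y → x ≡ y
iter-injective perm zero    eq = eq
iter-injective perm (suc m) eq = iter-injective perm m (perm _ _ eq)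

iter-* : ∀ {n} (τ : Vec (Fin n) n) {e x} → iter τ e x ≡ x → ∀ i → iter τ (i * e) x ≡ x
iter-* τ         eq zero    = refl
iter-* τ {e} {x} eq (suc i) = trans (iter-+ τ e (i * e) x) (trans (cong (iter τ e) (iter-* τ eq i)) eq)

iter-% : ∀ {n} (τ : Vec (Fin n) n) {e x} → iter τ (suc e) x ≡ x → ∀ m → iter τ (m % suc e) x ≡ iter τ m x
iter-% τ {e} {x} eq m = begin
  iter τ (m % suc e) x                                    ≡⟨ cong (iter τ (m % suc e)) (iter-* τ eq (m / suc e)) ⟨
  iter τ (m % suc e) (iter τ (m / suc e * suc e) x)       ≡⟨ iter-+ τ (m % suc e) (m / suc e * suc e) x ⟨
  iter τ (m % suc e + m / suc e * suc e) x                ≡⟨ cong (λ j → iter τ j x) (m≡m%n+[m/n]*n m (suc e)) ⟨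
  iter τ m x                                              ∎
  where open ≡-Reasoning

-- A period `e` of one point lets exponents be reduced modulo `e`; since every point is reached from
-- `x`, the reduced exponents embed `Fin n` into `Fin e`.
period≥n : ∀ {n} {τ : Vec (Fin n) n} → IsNCycle τ → ∀ {e x} → 0 < e → iter τ e x ≡ x → n ≤ e
period≥n {n} {τ} (_ , conn) {suc e} {x} _ eq = injective⇒≤ {f = code} code-injective
  where
  code : Fin n → Fin (suc e)
  code y = proj₁ (conn x y) mod suc e
  decode : ∀ y → iter τ (toℕ (code y)) x ≡ y
  decode y = trans (cong (λ m → iter τ m x) (toℕ-fromℕ< (m%n<n (proj₁ (conn x y)) (suc e))))
                   (trans (iter-% τ eq (proj₁ (conn x y))) (proj₂ (conn x y)))
  code-injective : ∀ {y z} → code y ≡ code z → y ≡ z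
  code-injective {y} {z} eq′ = trans (sym (decode y)) (trans (cong (λ i → iter τ (toℕ i) x) eq′) (decode z))

iter-cancel : ∀ {n} {τ : Vec (Fin n) n} → IsPerm τ → ∀ {a b x} → a ≤ b →
  iter τ a x ≡ iter τ b x → iter τ (b ∸ a) x ≡ x
iter-cancel {τ = τ} perm {a} {b} {x} a≤b eq = iter-injective perm a (begin
  iter τ a (iter τ (b ∸ a) x) ≡⟨ iter-+ τ a (b ∸ a) x ⟨
  iter τ (a + (b ∸ a)) x      ≡⟨ cong (λ m → iter τ m x) (m+[n∸m]≡n a≤b) ⟩
  iter τ b x                  ≡⟨ eq ⟨
  iter τ a x                  ∎)
  where open ≡-Reasoning

-- Among the exponents 0 to `n` two agree on `x`; their difference is a positive period of at most
-- `n`, and `period≥n` leaves only `n`.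
iter-n : ∀ {n} {τ : Vec (Fin n) n} → IsNCycle τ → ∀ x → iter τ n x ≡ x
iter-n {n} {τ} cyc@(perm , _) x
  with i , j , i<j , eq ← pigeonhole (n<1+n n) (λ i → iter τ (toℕ i) x) =
  subst (λ e → iter τ e x ≡ x)
    (≤-antisym (≤-trans (m∸n≤m (toℕ j) (toℕ i)) (toℕ≤pred[n] j)) (period≥n cyc (m<n⇒0<n∸m i<j) fix))
    fix
  where fix = iter-cancel perm (<⇒≤ i<j) eq

reach : ∀ {n} {τ : Vec (Fin (suc n)) (suc n)} → IsNCycle τ → ∀ x y → ∃[ i ] iter τ (toℕ {suc n} i) x ≡ y
reach {n} {τ} cyc@(_ , conn) x y with m , eq ← conn x y =
  m mod suc n ,
  trans (cong (λ j → iter τ j x) (toℕ-fromℕ< (m%n<n m (suc n)))) (trans (iter-% τ (iter-n cyc x) m) eq)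

-- For positive `e`, subtracting `n` from the period `e + e` leaves a period below `n`, which must
-- be 0.
doubled-period : ∀ {n} {τ : Vec (Fin n) n} → IsNCycle τ → ∀ {e x} → e < n →
  iter τ (e + e) x ≡ x → e ≡ 0 ⊎ e + e ≡ n
doubled-period {n}     cyc         {zero}  e<n eq = inj₁ refl
doubled-period {suc n} {τ} cyc@(perm , _) {suc e} {x} e<n eq = inj₂ (≤-antisym 2e≤n n≤2e)
  where
  n≤2e : suc n ≤ suc e + suc e
  n≤2e = period≥n cyc z<s eq
  fix : iter τ (suc e + suc e ∸ suc n) x ≡ x
  fix = iter-cancel perm n≤2e (trans (iter-n cyc x) (sym eq))
  2e∸n<n : suc e + suc e ∸ suc n < suc n
  2e∸n<n = m<n+o⇒m∸n<o (suc e + suc e) (suc n) (+-mono-< e<n e<n)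
  2e≤n : suc e + suc e ≤ suc n
  2e≤n with suc e + suc e ∸ suc n in eq′
  ... | zero  = m∸n≡0⇒m≤n eq′
  ... | suc r = contradiction (period≥n cyc (z<s {r}) (subst (λ m → iter τ m x ≡ x) eq′ fix)) (<⇒≱ (subst (_< suc n) eq′ 2e∸n<n))

-- `reach` bounds the exponent by the length of the cycle, so the existential becomes a finite
-- search.
IsNCycle? : ∀ {n} (τ : Vec (Fin (suc n)) (suc n)) → Dec (IsNCycle τ)
IsNCycle? τ = map′
  (λ (perm , r) → perm , λ x y → toℕ (proj₁ (r x y)) , proj₂ (r x y))
  (λ cyc → proj₁ cyc , reach cyc)
  (F.all? (λ i → F.all? (λ j → (lookup τ i F.≟ lookup τ j) →-dec (i F.≟ j)))
   ×-dec F.all? (λ x → F.all? (λ y → F.any? (λ i → iter τ (toℕ i) x F.≟ y))))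

-- Ascents and segmentations

toℕ-mod : ∀ {n j} → j ≤ n → toℕ (j mod suc n) ≡ j
toℕ-mod {n} {j} j≤n = trans (toℕ-fromℕ< (m%n<n j (suc n))) (m<n⇒m%n≡m (s≤s j≤n))

mod-toℕ : ∀ {n} (x : Fin (suc n)) → toℕ x mod suc n ≡ x
mod-toℕ x = toℕ-injective (toℕ-mod (toℕ≤pred[n] x))

isAscent : (ℕ → ℕ) → ℕ → ℕ
isAscent g j = if g j <ᵇ g (suc j) then 1 else 0

asc : (ℕ → ℕ) → ℕ → ℕ
asc g zero    = 0
asc g (suc j) = asc g j + isAscent g j

-- `asc` peels off the last position and `ascList` the first; this identity reconciles the two
-- recursions.
asc-shift : ∀ g j → asc g (suc j) ≡ isAscent g 0 + asc (λ i → g (suc i)) j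
asc-shift g zero    = sym (+-identityʳ (isAscent g 0))
asc-shift g (suc j) = trans (cong (_+ isAscent g (suc j)) (asc-shift g j)) (+-assoc (isAscent g 0) _ _)

ascList≡asc : ∀ {m l} (v : Vec (Fin m) (suc l)) g → (∀ i → g (toℕ i) ≡ toℕ (lookup v i)) → ascList (toList v) ≡ asc g l
ascList≡asc (a ∷ [])    g eq = refl
ascList≡asc (a ∷ b ∷ v) g eq = trans
  (cong₂ _+_ (cong₂ (λ p q → if p <ᵇ q then 1 else 0) (sym (eq zero)) (sym (eq (suc zero))))
             (ascList≡asc (b ∷ v) (λ i → g (suc i)) (λ i → eq (suc i))))
  (sym (asc-shift g _))

values : ∀ {n} → Vec (Fin (suc n)) (suc n) → ℕ → ℕ
values {n} τ j = toℕ (lookup τ (j mod suc n))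

values-toℕ : ∀ {n} (τ : Vec (Fin (suc n)) (suc n)) x → values τ (toℕ x) ≡ toℕ (lookup τ x)
values-toℕ τ x = cong (λ y → toℕ (lookup τ y)) (mod-toℕ x)

ascents≡asc : ∀ {n} (τ : Vec (Fin (suc n)) (suc n)) → ascents τ ≡ asc (values τ) n
ascents≡asc τ = ascList≡asc τ (values τ) (values-toℕ τ)

isAscent-< : ∀ g j → g j < g (suc j) → isAscent g j ≡ 1
isAscent-< g j lt with g j <ᵇ g (suc j) | <⇒<ᵇ lt
... | true | _ = refl

isAscent-≮ : ∀ g j → ¬ (g j < g (suc j)) → isAscent g j ≡ 0
isAscent-≮ g j ≮ with g j <ᵇ g (suc j) | <ᵇ⇒< (g j) (g (suc j))
... | true  | lt = contradiction (lt _) ≮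
... | false | _  = refl

asc-mono : ∀ g {i j} → i ≤ j → asc g i ≤ asc g j
asc-mono g {j = zero}  z≤n = ≤-refl
asc-mono g {i} {suc j} i≤j with m≤n⇒m<n∨m≡n i≤j
... | inj₁ (s≤s i≤j′) = ≤-trans (asc-mono g i≤j′) (m≤m+n (asc g j) _)
... | inj₂ refl       = ≤-refl

flat-step : ∀ g {j} → g j ≢ g (suc j) → asc g j ≡ asc g (suc j) → g (suc j) < g j
flat-step g {j} ≢ flat = ≤∧≢⇒< (≮⇒≥ ≮) (λ eq → ≢ (sym eq))
  where
  ≮ : ¬ (g j < g (suc j))
  ≮ lt = m+1+n≢m (asc g j) (trans (cong (asc g j +_) (sym (isAscent-< g j lt))) (sym flat))

-- Neighbouring values differ, so each position that is not an ascent is a descent, and descents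
-- chain.
asc-flat⇒decreasing : ∀ g {N} → (∀ j → j < N → g j ≢ g (suc j)) →
  ∀ {i j} → i < j → j ≤ N → asc g i ≡ asc g j → g j < g i
asc-flat⇒decreasing g inj {i} {suc j} (s≤s i≤j) j<N flat with m≤n⇒m<n∨m≡n i≤j
... | inj₂ refl = flat-step g (inj j j<N) flat
... | inj₁ i<j = <-trans (flat-step g (inj j j<N) (trans (sym flat′) flat)) (asc-flat⇒decreasing g inj i<j (<⇒≤ j<N) flat′)
  where
  flat′ : asc g i ≡ asc g j
  flat′ = ≤-antisym (asc-mono g i≤j) (≤-trans (m≤m+n (asc g j) _) (≤-reflexive (sym flat)))

-- Each ascent forces `ℓ` to rise by at least one. The inequality between the two increments is
-- written additively to avoid truncated subtraction.
asc-bound : ∀ g (ℓ : ℕ → ℕ) {N} → (∀ j → j < N → ℓ j ≤ ℓ (suc j)) → (∀ j → j < N → g j < g (suc j) → ℓ j ≢ ℓ (suc j)) →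
  ∀ {i j} → i ≤ j → j ≤ N → ℓ i + asc g j ≤ ℓ j + asc g i
asc-bound g ℓ mono jump {j = zero} z≤n _ = ≤-refl
asc-bound g ℓ mono jump {i} {suc j} i≤1+j j<N with m≤n⇒m<n∨m≡n i≤1+j
... | inj₂ refl       = ≤-refl
... | inj₁ (s≤s i≤j) = begin
  ℓ i + (asc g j + isAscent g j) ≡⟨ +-assoc (ℓ i) _ _ ⟨
  ℓ i + asc g j + isAscent g j   ≤⟨ +-monoˡ-≤ (isAscent g j) (asc-bound g ℓ mono jump i≤j (<⇒≤ j<N)) ⟩
  ℓ j + asc g i + isAscent g j   ≡⟨ +-assoc (ℓ j) _ _ ⟩
  ℓ j + (asc g i + isAscent g j) ≡⟨ cong (ℓ j +_) (+-comm (asc g i) _) ⟩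
  ℓ j + (isAscent g j + asc g i) ≡⟨ +-assoc (ℓ j) _ _ ⟨
  ℓ j + isAscent g j + asc g i   ≤⟨ +-monoˡ-≤ (asc g i) one ⟩
  ℓ (suc j) + asc g i        ∎
  where
  open ≤-Reasoning
  one : ℓ j + isAscent g j ≤ ℓ (suc j)
  one with g j <? g (suc j)
  ... | yes lt rewrite isAscent-< g j lt = subst (_≤ ℓ (suc j)) (+-comm 1 (ℓ j)) (≤∧≢⇒< (mono j j<N) (jump j j<N lt))
  ... | no  ≮  rewrite isAscent-≮ g j ≮ = subst (_≤ ℓ (suc j)) (sym (+-identityʳ (ℓ j))) (mono j j<N)

-- What the all-minus order imposes on first letters: they weakly increase with the rank of a shift,
-- and deleting a common first letter reverses the order.
record Segmentation {n} (τ : Vec (Fin n) n) (ℓ : Fin n → ℕ) : Set where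
  field
    mono : ∀ {x y} → x F.< y → ℓ x ≤ ℓ y
    anti : ∀ {x y} → x F.< y → ℓ x ≡ ℓ y → lookup τ y F.< lookup τ x

-- The coarsest segmentation: a new letter starts exactly after each ascent.
ascBefore : ∀ {n} → Vec (Fin (suc n)) (suc n) → Fin (suc n) → ℕ
ascBefore τ x = asc (values τ) (toℕ x)

ascBefore≤ascents : ∀ {n} (τ : Vec (Fin (suc n)) (suc n)) x → ascBefore τ x ≤ ascents τ
ascBefore≤ascents τ x = ≤-trans (asc-mono (values τ) (toℕ≤pred[n] x)) (≤-reflexive (sym (ascents≡asc τ)))

values-distinct : ∀ {n} {τ : Vec (Fin (suc n)) (suc n)} → IsPerm τ → ∀ j → j < n → values τ j ≢ values τ (suc j)
values-distinct perm j j<n eq = 1+n≢n (begin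
  suc j                 ≡⟨ toℕ-mod j<n ⟨
  toℕ (suc j mod suc _) ≡⟨ cong toℕ (perm _ _ (toℕ-injective eq)) ⟨
  toℕ (j mod suc _)     ≡⟨ toℕ-mod (<⇒≤ j<n) ⟩
  j                     ∎)
  where open ≡-Reasoning

ascBefore-flat : ∀ {n} {τ : Vec (Fin (suc n)) (suc n)} → IsPerm τ → ∀ {x y} → x F.< y →
  ascBefore τ x ≡ ascBefore τ y → lookup τ y F.< lookup τ x
ascBefore-flat {n} {τ} perm {x} {y} x<y eq =
  subst₂ _<_ (values-toℕ τ y) (values-toℕ τ x)
    (asc-flat⇒decreasing (values τ) (values-distinct {τ = τ} perm) x<y (toℕ≤pred[n] y) eq)

canonical : ∀ {n} {τ : Vec (Fin (suc n)) (suc n)} → IsPerm τ → Segmentation τ (ascBefore τ)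
canonical {τ = τ} perm = record { mono = λ x<y → asc-mono (values τ) (<⇒≤ x<y) ; anti = ascBefore-flat {τ = τ} perm }

-- Cutting off the point 0 makes its letter occur exactly once in every orbit.
markedLabel : ∀ {n} → Vec (Fin (suc n)) (suc n) → Fin (suc n) → ℕ
markedLabel τ zero      = 0
markedLabel τ x@(suc _) = suc (ascBefore τ x)

marked : ∀ {n} {τ : Vec (Fin (suc n)) (suc n)} → IsPerm τ → Segmentation τ (markedLabel τ)
marked {n} {τ} perm = record { mono = mono ; anti = anti }
  where
  mono : ∀ {x y} → x F.< y → markedLabel τ x ≤ markedLabel τ y
  mono {zero}          _   = z≤n
  mono {suc _} {suc _} x<y = s≤s (asc-mono (values τ) (<⇒≤ x<y))
  anti : ∀ {x y} → x F.< y → markedLabel τ x ≡ markedLabel τ y → lookup τ y F.< lookup τ x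
  anti {suc _} {suc _} x<y eq = ascBefore-flat {τ = τ} perm x<y (suc-injective eq)

label-bound : ∀ {n} {τ : Vec (Fin (suc n)) (suc n)} {ℓ} → Segmentation τ ℓ → ∀ x y → x F.≤ y →
  ℓ x + ascBefore τ y ≤ ℓ y + ascBefore τ x
label-bound {n} {τ} {ℓ} seg x y x≤y =
  subst₂ (λ a b → ℓ a + ascBefore τ y ≤ ℓ b + ascBefore τ x) (mod-toℕ x) (mod-toℕ y)
    (asc-bound (values τ) (λ j → ℓ (j mod suc n)) mono′ jump x≤y (toℕ≤pred[n] y))
  where
  open Segmentation seg
  adj : ∀ j → j < n → (j mod suc n) F.< (suc j mod suc n)
  adj j j<n = ≤-reflexive (trans (cong suc (toℕ-mod (<⇒≤ j<n))) (sym (toℕ-mod j<n)))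
  mono′ : ∀ j → j < n → ℓ (j mod suc n) ≤ ℓ (suc j mod suc n)
  mono′ j j<n = mono (adj j j<n)
  jump : ∀ j → j < n → values τ j < values τ (suc j) → ℓ (j mod suc n) ≢ ℓ (suc j mod suc n)
  jump j j<n lt eq = <-asym lt (anti (adj j j<n) eq)

ascents≤label : ∀ {n} {τ : Vec (Fin (suc n)) (suc n)} {ℓ} → Segmentation τ ℓ → ∀ {k} → (∀ x → ℓ x < k) → ascents τ + 1 ≤ k
ascents≤label {n} {τ} {ℓ} seg {k} ℓ<k = begin
  ascents τ + 1                        ≡⟨ +-comm _ 1 ⟩
  suc (ascents τ)                      ≡⟨ cong suc (trans (ascents≡asc τ) (cong (asc (values τ)) (sym (toℕ-fromℕ n)))) ⟩
  suc (ascBefore τ (F.fromℕ n))        ≤⟨ s≤s (m≤n+m _ (ℓ zero)) ⟩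
  suc (ℓ zero + ascBefore τ (F.fromℕ n)) ≤⟨ s≤s (label-bound seg zero (F.fromℕ n) z≤n) ⟩
  suc (ℓ (F.fromℕ n) + 0)              ≡⟨ cong suc (+-identityʳ _) ⟩
  suc (ℓ (F.fromℕ n))                  ≤⟨ ℓ<k (F.fromℕ n) ⟩
  k                                    ∎
  where
  open ≤-Reasoning

-- With no letter to spare, comparing `x` with rank 0 bounds its label from below, and comparing it
-- with the last rank bounds it from above.
tight-label : ∀ {n} {τ : Vec (Fin (suc n)) (suc n)} {ℓ} → Segmentation τ ℓ → ∀ {k} → (∀ x → ℓ x < k) → ascents τ + 1 ≡ k →
  ∀ x → ℓ x ≡ ascBefore τ x
tight-label {n} {τ} {ℓ} seg {k} ℓ<k refl x = ≤-antisym upper lower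
  where
  last : Fin (suc n)
  last = F.fromℕ n
  last≡ : ascBefore τ last ≡ ascents τ
  last≡ = trans (cong (asc (values τ)) (toℕ-fromℕ n)) (sym (ascents≡asc τ))
  lower : ascBefore τ x ≤ ℓ x
  lower = ≤-trans (m≤n+m _ (ℓ zero)) (≤-trans (label-bound seg zero x z≤n) (≤-reflexive (+-identityʳ _)))
  upper : ℓ x ≤ ascBefore τ x
  upper = +-cancelʳ-≤ (ascents τ) _ _ (begin
    ℓ x + ascents τ        ≡⟨ cong (ℓ x +_) last≡ ⟨
    ℓ x + ascBefore τ last ≤⟨ label-bound seg x last (subst (toℕ x ≤_) (sym (toℕ-fromℕ n)) (toℕ≤pred[n] x)) ⟩
    ℓ last + ascBefore τ x ≤⟨ +-monoˡ-≤ (ascBefore τ x) (m<1+n⇒m≤n (subst (ℓ last <_) (+-comm _ 1) (ℓ<k last))) ⟩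
    ascents τ + ascBefore τ x ≡⟨ +-comm (ascents τ) _ ⟩
    ascBefore τ x + ascents τ ∎)
    where open ≤-Reasoning

-- Words read along an orbit

-- Each minus sign passed exchanges the arguments, so this is how letters at position `j` are
-- compared.
Alt : {A : Set} → (A → A → Set) → ℕ → A → A → Set
Alt R zero    x y = R x y
Alt R (suc j) x y = Alt R j y x

Alt-even : {A : Set} {R : A → A → Set} → ∀ j {x y} → j % 2 ≡ 0 → Alt R j x y → R x y
Alt-even zero          _  r = r
Alt-even (suc (suc j)) eq r = Alt-even j eq r

Alt⁺ : {A : Set} {R : A → A → Set} → ∀ j {x y} → (j % 2 ≡ 0 × R x y) ⊎ (j % 2 ≡ 1 × R y x) → Alt R j x y
Alt⁺ zero          (inj₁ (_ , r))  = r
Alt⁺ (suc zero)    (inj₂ (_ , r))  = r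
Alt⁺ (suc (suc j)) r               = Alt⁺ j r

Alt⁻ : {A : Set} {R : A → A → Set} → ∀ j {x y} → Alt R j x y → (j % 2 ≡ 0 × R x y) ⊎ (j % 2 ≡ 1 × R y x)
Alt⁻ zero          r = inj₁ (refl , r)
Alt⁻ (suc zero)    r = inj₂ (refl , r)
Alt⁻ (suc (suc j)) r = Alt⁻ j r

Alt-irrefl : ∀ {n} j {x : Fin n} → ¬ Alt F._<_ j x x
Alt-irrefl zero    r = F.<-irrefl refl r
Alt-irrefl (suc j) r = Alt-irrefl j r

Alt-asym : ∀ {n} j {x y : Fin n} → Alt F._<_ j x y → ¬ Alt F._<_ j y x
Alt-asym zero    r r′ = F.<-asym r r′
Alt-asym (suc j) r r′ = Alt-asym j r r′

countMinus-allMinus : ∀ {k} (s : Word k) j → countMinus allMinus s j ≡ j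
countMinus-allMinus s zero    = refl
countMinus-allMinus s (suc j) = trans (cong (_+ 1) (countMinus-allMinus s j)) (+-comm j 1)

-- When all signs are minus, the number of minus signs passed is the position itself.
≺⇔Alt : ∀ {k} (s t : Word k) →
  (s ≺[ allMinus ] t) ⇔ (∃[ j ] ((∀ m → m < j → s m ≡ t m) × Alt F._<_ j (s j) (t j)))
≺⇔Alt s t = mk⇔
  (λ (j , pre , lt) → j , pre , Alt⁺ j (subst (Compare j) (countMinus-allMinus s j) lt))
  (λ (j , pre , r) → j , pre , subst (Compare j) (sym (countMinus-allMinus s j)) (Alt⁻ j r))
  where
  Compare : ℕ → ℕ → Set
  Compare j c = (c % 2 ≡ 0 × s j F.< t j) ⊎ (c % 2 ≡ 1 × t j F.< s j)

SameWord : ∀ {n} → Vec (Fin n) n → (Fin n → ℕ) → Fin n → Fin n → Set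
SameWord τ ℓ x y = ∀ j → ℓ (iter τ j x) ≡ ℓ (iter τ j y)

-- Equal words stay in the same relative order under an even power of τ, so along
-- the powers of τ ^ (e + e) the orbit of x would be strictly monotone.
module SquarePeriod {n : ℕ} (τ : Vec (Fin n) n) (ℓ : Fin n → ℕ) (cyc : IsNCycle τ) (e : ℕ) (x : Fin n)
  (same : SameWord τ ℓ x (iter τ e x)) where

  u : ℕ
  u = e + e

  even : ∀ i → i * u % 2 ≡ 0
  even i = trans (cong (_% 2) i*u≡) (m*n%n≡0 (i * e) 2)
    where
    i*u≡ : i * u ≡ i * e * 2
    i*u≡ = trans (*-distribˡ-+ i e e) (trans (cong (i * e +_) (sym (+-identityʳ (i * e)))) (*-comm 2 (i * e)))

  same² : SameWord τ ℓ x (iter τ u x)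
  same² j = begin
    ℓ (iter τ j x)                     ≡⟨ same j ⟩
    ℓ (iter τ j (iter τ e x))          ≡⟨ cong ℓ (iter-+ τ j e x) ⟨
    ℓ (iter τ (j + e) x)               ≡⟨ same (j + e) ⟩
    ℓ (iter τ (j + e) (iter τ e x))    ≡⟨ cong ℓ (iter-+ τ j e (iter τ e x)) ⟩
    ℓ (iter τ j (iter τ e (iter τ e x))) ≡⟨ cong (λ y → ℓ (iter τ j y)) (iter-+ τ e e x) ⟨
    ℓ (iter τ j (iter τ u x))          ∎
    where open ≡-Reasoning

  returns : (R : Fin n → Fin n → Set) → Transitive R → (∀ i → R (iter τ (i * u) x) (iter τ (i * u) (iter τ u x))) → R x x
  -- After `n` rounds the exponent is `n * u`, a multiple of the cycle length, so the chain ends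
  -- where it began.
  returns R R-trans up = subst (R x) (trans (cong (λ m → iter τ m x) (*-comm n u)) (iter-* τ (iter-n cyc x) u)) (chain′ n z<n)
    where
    z<n : 0 < n
    z<n = ≤-trans (s≤s z≤n) (toℕ<n x)
    up′ : ∀ i → R (iter τ (i * u) x) (iter τ (suc i * u) x)
    up′ i = subst (R _) (trans (iter-comm τ (i * u) u x) (sym (iter-+ τ u (i * u) x))) (up i)
    chain : ∀ i → R x (iter τ (suc i * u) x)
    chain zero    = up′ 0
    chain (suc i) = R-trans (chain i) (up′ (suc i))
    chain′ : ∀ i → 0 < i → R x (iter τ (i * u) x)
    chain′ (suc i) _ = chain i

module _ {n : ℕ} {τ : Vec (Fin n) n} {ℓ : Fin n → ℕ} (seg : Segmentation τ ℓ) where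
  open Segmentation seg

  -- As long as the letters agree, both points lie in one segment, and `anti` reverses their order
  -- once per step.
  iter-Alt : ∀ j {x y} → (∀ m → m < j → ℓ (iter τ m x) ≡ ℓ (iter τ m y)) → x F.< y →
    Alt F._<_ j (iter τ j x) (iter τ j y)
  iter-Alt zero    pre x<y = x<y
  iter-Alt (suc j) pre x<y = flip-step j (pre j ≤-refl) (iter-Alt j (λ m m<j → pre m (m<n⇒m<1+n m<j)) x<y)
    where
    flip-step : ∀ j {x y} → ℓ x ≡ ℓ y → Alt F._<_ j x y → Alt F._<_ j (lookup τ y) (lookup τ x)
    flip-step zero    eq r = anti r eq
    flip-step (suc j) eq r = flip-step j (sym eq) r

  label-reflects-< : ∀ {x y} → ℓ x < ℓ y → x F.< y
  label-reflects-< {x} {y} lt with F.<-cmp x y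
  ... | tri< x<y _ _  = x<y
  ... | tri≈ _ refl _ = contradiction lt (<-irrefl refl)
  ... | tri> _ _ y<x  = contradiction (mono y<x) (<⇒≱ lt)

  Alt-label⁻ : ∀ j {x y} → Alt _<_ j (ℓ x) (ℓ y) → Alt F._<_ j x y
  Alt-label⁻ zero    r = label-reflects-< r
  Alt-label⁻ (suc j) r = Alt-label⁻ j r

  Alt-label⁺ : ∀ j {x y} → ℓ x ≢ ℓ y → Alt F._<_ j x y → Alt _<_ j (ℓ x) (ℓ y)
  Alt-label⁺ zero    ne r = ≤∧≢⇒< (mono r) ne
  Alt-label⁺ (suc j) ne r = Alt-label⁺ j (λ eq → ne (sym eq)) r

  -- If `y` were below `x`, `iter-Alt` would put their images at position `j` in the order opposite
  -- to the one their letters show.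
  lex⇒< : ∀ j {x y} → (∀ m → m < j → ℓ (iter τ m x) ≡ ℓ (iter τ m y)) →
    Alt _<_ j (ℓ (iter τ j x)) (ℓ (iter τ j y)) → x F.< y
  lex⇒< j {x} {y} pre r with F.<-cmp x y
  ... | tri< x<y _ _  = x<y
  ... | tri≈ _ refl _ = contradiction (Alt-label⁻ j r) (Alt-irrefl j)
  ... | tri> _ _ y<x  = contradiction (iter-Alt j (λ m m<j → sym (pre m m<j)) y<x) (Alt-asym j (Alt-label⁻ j r))

  -- A strict comparison of `x` with `iter τ (e + e) x` would propagate round the orbit with
  -- unchanged direction, the exponents being even, and end in `x` being below itself.
  SameWord-period : IsNCycle τ → ∀ {e x} → SameWord τ ℓ x (iter τ e x) → iter τ (e + e) x ≡ x
  SameWord-period cyc {e} {x} same with F.<-cmp x (iter τ (e + e) x)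
  ... | tri≈ _ eq _ = sym eq
  ... | tri< lt _ _ = contradiction
    (returns F._<_ F.<-trans (λ i → Alt-even (i * u) (even i) (iter-Alt (i * u) (λ m _ → same² m) lt))) (F.<-irrefl refl)
    where open SquarePeriod τ ℓ cyc e x same
  ... | tri> _ _ gt = contradiction
    (returns F._>_ (λ p q → F.<-trans q p) (λ i →
       Alt-even (i * u) (even i) (iter-Alt (i * u) (λ m _ → sym (same² m)) gt))) (F.<-irrefl refl)
    where open SquarePeriod τ ℓ cyc e x same

-- Permutations obtained by reading a cycle from a starting point

orbit : ∀ {n} → Vec (Fin n) n → Fin n → Vec (Fin n) n
orbit τ x = tabulate (λ i → iter τ (toℕ i) x)

lookup-orbit : ∀ {n} (τ : Vec (Fin n) n) x i → lookup (orbit τ x) i ≡ iter τ (toℕ i) x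
lookup-orbit τ x i = lookup∘tabulate (λ i → iter τ (toℕ i) x) i

iter-mod : ∀ {n} {τ : Vec (Fin (suc n)) (suc n)} → IsNCycle τ → ∀ x m → iter τ (toℕ (m mod suc n)) x ≡ iter τ m x
iter-mod {n} {τ} cyc x m = trans (cong (λ j → iter τ j x) (toℕ-fromℕ< (m%n<n m (suc n)))) (iter-% τ (iter-n cyc x) m)

-- Words along a cycle have period `suc n`, so different words differ below `suc n`, where the least
-- position can be searched for.
firstDifference : ∀ {n} {τ : Vec (Fin (suc n)) (suc n)} → IsNCycle τ → ∀ {ℓ x y} → ¬ SameWord τ ℓ x y →
  ∃[ m ] ((∀ m′ → m′ < m → ℓ (iter τ m′ x) ≡ ℓ (iter τ m′ y)) × ℓ (iter τ m x) ≢ ℓ (iter τ m y))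
firstDifference {n} {τ} cyc {ℓ} {x} {y} ¬same =
  let i , ne , pre = ¬∀⟶∃¬-smallest (suc n) (λ i → ℓ (iter τ (toℕ i) x) ≡ ℓ (iter τ (toℕ i) y))
         (λ i → ℓ (iter τ (toℕ i) x) ≟ ℓ (iter τ (toℕ i) y))
         (λ all → ¬same (λ m → trans (cong ℓ (sym (iter-mod cyc x m))) (trans (all (m mod suc n)) (cong ℓ (iter-mod cyc y m))))) in
  toℕ i ,
  (λ m lt → subst (λ m → ℓ (iter τ m x) ≡ ℓ (iter τ m y)) (trans (toℕ-inject (F.fromℕ< lt)) (toℕ-fromℕ< lt)) (pre (F.fromℕ< lt))) ,
  ne

orbit-isPerm : ∀ {n} {τ : Vec (Fin n) n} → IsNCycle τ → ∀ x → IsPerm (orbit τ x)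
orbit-isPerm {n} {τ} cyc@(perm , _) x i j eq = decide (F.<-cmp i j)
  where
  eq′ : iter τ (toℕ i) x ≡ iter τ (toℕ j) x
  eq′ = trans (sym (lookup-orbit τ x i)) (trans eq (lookup-orbit τ x j))
  distinct : ∀ {i j : Fin n} → i F.< j → iter τ (toℕ i) x ≢ iter τ (toℕ j) x
  distinct {i} {j} i<j eq =
    <⇒≱ (≤-<-trans (m∸n≤m (toℕ j) (toℕ i)) (toℕ<n j)) (period≥n cyc (m<n⇒0<n∸m i<j) (iter-cancel perm (<⇒≤ i<j) eq))
  decide : Tri (i F.< j) (i ≡ j) (j F.< i) → i ≡ j
  decide (tri≈ _ i≡j _) = i≡j
  decide (tri< i<j _ _) = contradiction eq′ (distinct i<j)
  decide (tri> _ _ j<i) = contradiction (sym eq′) (distinct j<i)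

lookup-ext : ∀ {A : Set} {m} {u v : Vec A m} → (∀ i → lookup u i ≡ lookup v i) → u ≡ v
lookup-ext {u = u} {v} eq = trans (sym (tabulate∘lookup u)) (trans (tabulate-cong eq) (tabulate∘lookup v))

-- The entries give the images of `x` under all powers; these reach every point and so determine
-- `τ`, and entry 0 is `x`.
orbit-injective : ∀ {n} {τ τ′ : Vec (Fin (suc n)) (suc n)} → IsNCycle τ → IsNCycle τ′ → ∀ {x x′} →
  orbit τ x ≡ orbit τ′ x′ → τ ≡ τ′ × x ≡ x′
orbit-injective {n} {τ} {τ′} cyc cyc′ {x} {x′} eq = lookup-ext agree-τ , agree 0
  where
  agree : ∀ m → iter τ m x ≡ iter τ′ m x′
  agree m = begin
    iter τ m x                        ≡⟨ iter-mod cyc x m ⟨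
    iter τ (toℕ (m mod suc n)) x      ≡⟨ lookup-orbit τ x (m mod suc n) ⟨
    lookup (orbit τ x) (m mod suc n)  ≡⟨ cong (λ π → lookup π (m mod suc n)) eq ⟩
    lookup (orbit τ′ x′) (m mod suc n) ≡⟨ lookup-orbit τ′ x′ (m mod suc n) ⟩
    iter τ′ (toℕ (m mod suc n)) x′    ≡⟨ iter-mod cyc′ x′ m ⟩
    iter τ′ m x′                      ∎
    where open ≡-Reasoning
  agree-τ : ∀ y → lookup τ y ≡ lookup τ′ y
  agree-τ y with m , refl ← proj₂ cyc x y = trans (agree (suc m)) (cong (lookup τ′) (sym (agree m)))

-- The word lists the labels met on the orbit of `x₀`. Its shifts first differ where the labels of
-- the corresponding points do; there `iter-Alt` and `lex⇒<` match word order with rank order in the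
-- two directions.
realise : ∀ {n k} {τ : Vec (Fin (suc n)) (suc n)} {ℓ} → IsNCycle τ → Segmentation τ ℓ → (∀ x → ℓ x < k) →
  (∀ x y → SameWord τ ℓ x y → x ≡ y) → ∀ x₀ → InPatterns (suc n) k allMinus (orbit τ x₀)
realise {n} {k} {τ} {ℓ} cyc seg ℓ<k separates x₀ = orbit-isPerm cyc x₀ , s , prim , isPattern
  where
  letter : ℕ → Fin k
  letter m = F.fromℕ< (ℓ<k (iter τ m x₀))

  w : ℕ → ℕ
  w m = ℓ (iter τ m x₀)

  s : Vec (Fin k) (suc n)
  s = tabulate (λ i → letter (toℕ i))

  toℕ-s : ∀ i → toℕ (lookup s i) ≡ w (toℕ i)
  toℕ-s i = trans (cong toℕ (lookup∘tabulate (λ i → letter (toℕ i)) i)) (toℕ-fromℕ< (ℓ<k _))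

  w-mod : ∀ m → w (m % suc n) ≡ w m
  w-mod m = cong ℓ (iter-% τ (iter-n cyc x₀) m)

  toℕ-periodic : ∀ m → toℕ (periodic s m) ≡ w m
  toℕ-periodic m = trans (toℕ-s (m mod suc n)) (cong ℓ (iter-mod cyc x₀ m))

  w-shift : ∀ a m → w (a + m) ≡ ℓ (iter τ m (iter τ a x₀))
  w-shift a m = cong ℓ (trans (iter-+ τ a m x₀) (iter-comm τ a m x₀))

  toℕ-shift : ∀ a m → toℕ (shiftBy a (periodic s) m) ≡ ℓ (iter τ m (iter τ a x₀))
  toℕ-shift a m = trans (toℕ-periodic (a + m)) (w-shift a m)

  prim : Primitive s
  prim d@(suc _) 0<d d<n d∣n per =
    <⇒≱ d<n (period≥n cyc 0<d (sym (separates x₀ (iter τ d x₀) same)))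
    where
    w-step : ∀ a → a + d < suc n → w a ≡ w (a + d)
    w-step a a+d<n = begin
      w a                       ≡⟨ cong w (toℕ-fromℕ< a<n) ⟨
      w (toℕ (F.fromℕ< a<n))    ≡⟨ toℕ-s (F.fromℕ< a<n) ⟨
      toℕ (lookup s (F.fromℕ< a<n)) ≡⟨ cong toℕ (per (F.fromℕ< a<n) (F.fromℕ< a+d<n)
          (trans (toℕ-fromℕ< a+d<n) (cong (_+ d) (sym (toℕ-fromℕ< a<n))))) ⟩
      toℕ (lookup s (F.fromℕ< a+d<n)) ≡⟨ toℕ-s (F.fromℕ< a+d<n) ⟩
      w (toℕ (F.fromℕ< a+d<n))  ≡⟨ cong w (toℕ-fromℕ< a+d<n) ⟩
      w (a + d)                 ∎
      where
      open ≡-Reasoning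
      a<n : a < suc n
      a<n = ≤-<-trans (m≤m+n a d) a+d<n
    -- The assumed repetition concerns positions inside one period only, hence the bound.
    w-steps : ∀ q a → a + q * d < suc n → w a ≡ w (a + q * d)
    w-steps zero    a lt = cong w (sym (+-identityʳ a))
    w-steps (suc q) a lt = trans (w-step a (≤-<-trans (+-monoʳ-≤ a (m≤m+n d (q * d))) lt))
      (trans (w-steps q (a + d) (subst (_< suc n) (sym (+-assoc a d (q * d))) lt)) (cong w (+-assoc a d (q * d))))
    -- Reduction modulo the full length brings the position inside the word; as `d` divides that
    -- length, the residue modulo `d` survives.
    w-%d : ∀ m → w (m % d) ≡ w m
    w-%d m = begin
      w (m % d)            ≡⟨ cong w (m∣n⇒o%n%m≡o%m d (suc n) m d∣n) ⟨
      w (r % d)            ≡⟨ w-steps (r / d) (r % d) (subst (_< suc n) (m≡m%n+[m/n]*n r d) (m%n<n m (suc n))) ⟩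
      w (r % d + r / d * d) ≡⟨ cong w (m≡m%n+[m/n]*n r d) ⟨
      w r                  ≡⟨ w-mod m ⟩
      w m                  ∎
      where
      open ≡-Reasoning
      r = m % suc n
    same : SameWord τ ℓ x₀ (iter τ d x₀)
    same j = begin
      w j           ≡⟨ w-%d j ⟨
      w (j % d)     ≡⟨ cong w ([m+n]%n≡m%n j d) ⟨
      w ((j + d) % d) ≡⟨ w-%d (j + d) ⟩
      w (j + d)     ≡⟨ cong ℓ (iter-+ τ j d x₀) ⟩
      ℓ (iter τ j (iter τ d x₀)) ∎
      where open ≡-Reasoning

  isPattern : IsPattern allMinus s (orbit τ x₀)
  isPattern i j = mk⇔
    (λ x<y → from (≺⇔Alt (shiftBy (toℕ i) (periodic s)) (shiftBy (toℕ j) (periodic s)))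
      (fwd (subst₂ F._<_ (lookup-orbit τ x₀ i) (lookup-orbit τ x₀ j) x<y)))
    (λ lt → let m , pre , r = to (≺⇔Alt (shiftBy (toℕ i) (periodic s)) (shiftBy (toℕ j) (periodic s))) lt in
      subst₂ F._<_ (sym (lookup-orbit τ x₀ i)) (sym (lookup-orbit τ x₀ j))
        (lex⇒< seg m (λ m′ lt′ → trans (sym (toℕ-shift (toℕ i) m′)) (trans (cong toℕ (pre m′ lt′)) (toℕ-shift (toℕ j) m′)))
        (subst₂ (Alt _<_ m) (toℕ-shift (toℕ i) m) (toℕ-shift (toℕ j) m) (Alt-toℕ⁺ m r))))
    where
    x y : Fin (suc n)
    x = iter τ (toℕ i) x₀
    y = iter τ (toℕ j) x₀
    Alt-toℕ⁺ : ∀ m {a b : Fin k} → Alt F._<_ m a b → Alt _<_ m (toℕ a) (toℕ b)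
    Alt-toℕ⁺ zero    r = r
    Alt-toℕ⁺ (suc m) r = Alt-toℕ⁺ m r
    Alt-toℕ⁻ : ∀ m {a b : Fin k} → Alt _<_ m (toℕ a) (toℕ b) → Alt F._<_ m a b
    Alt-toℕ⁻ zero    r = r
    Alt-toℕ⁻ (suc m) r = Alt-toℕ⁻ m r
    fwd : x F.< y → ∃[ m ] ((∀ m′ → m′ < m → shiftBy (toℕ i) (periodic s) m′ ≡ shiftBy (toℕ j) (periodic s) m′) ×
      Alt F._<_ m (shiftBy (toℕ i) (periodic s) m) (shiftBy (toℕ j) (periodic s) m))
    fwd x<y = let m , pre , ne = firstDifference cyc {ℓ = ℓ} (λ same → F.<⇒≢ x<y (separates x y same)) in
      m ,
      (λ m′ lt → toℕ-injective (trans (toℕ-shift (toℕ i) m′) (trans (pre m′ lt) (sym (toℕ-shift (toℕ j) m′))))) ,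
      Alt-toℕ⁻ m (subst₂ (Alt _<_ m) (sym (toℕ-shift (toℕ i) m)) (sym (toℕ-shift (toℕ j) m))
        (Alt-label⁺ seg m ne (iter-Alt seg m pre x<y)))

-- Doubling

toℕ-pair₀ : ∀ {d} (q : Fin d) → toℕ (combine q (zero {1})) ≡ toℕ q * 2
toℕ-pair₀ q = trans (toℕ-combine q zero) (trans (+-identityʳ _) (*-comm 2 (toℕ q)))

toℕ-pair₁ : ∀ {d} (q : Fin d) → toℕ (combine q (suc (zero {0}))) ≡ suc (toℕ q * 2)
toℕ-pair₁ q = trans (toℕ-combine q (suc zero)) (trans (+-comm _ 1) (cong suc (*-comm 2 (toℕ q))))

pair-< : ∀ {d} (q : Fin d) → combine q (zero {1}) F.< combine q (suc zero)
pair-< q = subst₂ _<_ (sym (toℕ-pair₀ q)) (sym (toℕ-pair₁ q)) ≤-refl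

-- Each point q of ρ is replaced by the adjacent pair 2q, 2q + 1, and each pair is
-- mapped to the next one in reversed order.
doubleAt : ∀ {d} → Vec (Fin d) d → Fin d × Fin 2 → Fin (d * 2)
doubleAt ρ (q , r) = combine (lookup ρ q) (opposite r)

double : ∀ {d} → Vec (Fin d) d → Vec (Fin (d * 2)) (d * 2)
double ρ = tabulate (λ y → doubleAt ρ (remQuot 2 y))

lookup-double : ∀ {d} (ρ : Vec (Fin d) d) q r → lookup (double ρ) (combine q r) ≡ combine (lookup ρ q) (opposite r)
lookup-double ρ q r = trans (lookup∘tabulate (λ y → doubleAt ρ (remQuot 2 y)) (combine q r)) (cong (doubleAt ρ) (remQuot-combine q r))

opposite-injective : ∀ {n} {i j : Fin n} → opposite i ≡ opposite j → i ≡ j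
opposite-injective {i = i} {j} eq = trans (sym (opposite-involutive i)) (trans (cong opposite eq) (opposite-involutive j))

≢⇒opposite : ∀ (r r′ : Fin 2) → r ≢ r′ → opposite r ≡ r′
≢⇒opposite zero       zero       ne = contradiction refl ne
≢⇒opposite zero       (suc zero) ne = refl
≢⇒opposite (suc zero) zero       ne = refl
≢⇒opposite (suc zero) (suc zero) ne = contradiction refl ne

double-injective : ∀ {d} {ρ ρ′ : Vec (Fin d) d} → double ρ ≡ double ρ′ → ρ ≡ ρ′
double-injective {ρ = ρ} {ρ′} eq = lookup-ext (λ q → combine-injectiveˡ _ (opposite zero) _ (opposite zero)
  (trans (sym (lookup-double ρ q zero)) (trans (cong (λ τ → lookup τ (combine q zero)) eq) (lookup-double ρ′ q zero))))

flips : ℕ → Fin 2 → Fin 2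
flips zero    r = r
flips (suc m) r = opposite (flips m r)

flips-odd : ∀ c m r → flips (suc (c * 2) + m) r ≡ opposite (flips m r)
flips-odd zero    m r = refl
flips-odd (suc c) m r = trans (opposite-involutive (flips (suc (c * 2) + m) r)) (flips-odd c m r)

iter-double : ∀ {d} (ρ : Vec (Fin d) d) m q r → iter (double ρ) m (combine q r) ≡ combine (iter ρ m q) (flips m r)
iter-double ρ zero    q r = refl
iter-double ρ (suc m) q r = trans (cong (lookup (double ρ)) (iter-double ρ m q r)) (lookup-double ρ (iter ρ m q) (flips m r))

-- One round of `ρ` returns to `q`, and an odd number of reversals exchanges the two members of the
-- pair.
iter-double-odd : ∀ c {ρ : Vec (Fin (suc (c * 2))) (suc (c * 2))} → IsNCycle ρ → ∀ q r →
  iter (double ρ) (suc (c * 2)) (combine q r) ≡ combine q (opposite r)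
iter-double-odd c {ρ} cyc q r = trans (iter-double ρ (suc (c * 2)) q r)
  (cong₂ combine (iter-n cyc q) (trans (cong (λ m → flips m r) (sym (+-identityʳ (suc (c * 2))))) (flips-odd c 0 r)))

double-cycle : ∀ c {ρ : Vec (Fin (suc (c * 2))) (suc (c * 2))} → IsNCycle ρ → IsNCycle (double ρ)
double-cycle c {ρ} cyc@(perm , conn) = perm′ , conn′
  where
  d = suc (c * 2)
  perm′ : IsPerm (double ρ)
  perm′ x y eq with q , r , refl ← combine-surjective {d} x | q′ , r′ , refl ← combine-surjective {d} y =
    let e₁ , e₂ = combine-injective (lookup ρ q) (opposite r) (lookup ρ q′) (opposite r′)
                    (trans (sym (lookup-double ρ q r)) (trans eq (lookup-double ρ q′ r′)))
    in cong₂ combine (perm q q′ e₁) (opposite-injective e₂)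
  conn′ : ∀ x y → ∃[ m ] (iter (double ρ) m x ≡ y)
  conn′ x y with q , r , refl ← combine-surjective {d} x | q′ , r′ , refl ← combine-surjective {d} y
    with m , refl ← conn q q′
    with flips m r F.≟ r′
  ... | yes refl = m , iter-double ρ m q r
  -- The right pair is reached at the wrong member; `d` further steps exchange the members.
  ... | no ne = d + m , (begin
    iter (double ρ) (d + m) (combine q r)               ≡⟨ iter-+ (double ρ) d m (combine q r) ⟩
    iter (double ρ) d (iter (double ρ) m (combine q r)) ≡⟨ cong (iter (double ρ) d) (iter-double ρ m q r) ⟩
    iter (double ρ) d (combine (iter ρ m q) (flips m r)) ≡⟨ iter-double-odd c cyc (iter ρ m q) (flips m r) ⟩
    combine (iter ρ m q) (opposite (flips m r))         ≡⟨ cong (combine (iter ρ m q)) (≢⇒opposite _ _ ne) ⟩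
    combine (iter ρ m q) r′                             ∎)
    where open ≡-Reasoning

double-cycle⁻ : ∀ {d} {ρ : Vec (Fin d) d} → IsNCycle (double ρ) → IsNCycle ρ
double-cycle⁻ {d} {ρ} (perm , conn) =
  (λ q q′ eq → combine-injectiveˡ q (zero {1}) q′ zero (perm _ _
    (trans (lookup-double ρ q zero) (trans (cong (λ a → combine a (opposite zero)) eq) (sym (lookup-double ρ q′ zero)))))) ,
  (λ q q′ → let m , eq = conn (combine q zero) (combine q′ zero) in
    m , combine-injectiveˡ _ (flips m zero) q′ zero (trans (sym (iter-double ρ m q zero)) eq))

module _ {d′ : ℕ} (ρ : Vec (Fin (suc d′)) (suc d′)) where
  private
    g = values ρ
    g₂ = values (double ρ)

  values-double : ∀ {j} → j ≤ d′ → ∀ r → g₂ (2 * j + toℕ r) ≡ 2 * g j + toℕ (opposite {2} r)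
  values-double {j} j≤d′ r = begin
    g₂ (2 * j + toℕ r)                                ≡⟨ cong (λ i → g₂ (2 * i + toℕ r)) (toℕ-mod j≤d′) ⟨
    g₂ (2 * toℕ q + toℕ r)                            ≡⟨ cong g₂ (toℕ-combine q r) ⟨
    g₂ (toℕ (combine q r))                            ≡⟨ values-toℕ (double ρ) (combine q r) ⟩
    toℕ (lookup (double ρ) (combine q r))             ≡⟨ cong toℕ (lookup-double ρ q r) ⟩
    toℕ (combine (lookup ρ q) (opposite r))           ≡⟨ toℕ-combine (lookup ρ q) (opposite r) ⟩
    2 * g j + toℕ (opposite r)                        ∎
    where
    open ≡-Reasoning
    q : Fin (suc d′)
    q = j mod suc d′

  values-double-even : ∀ {j} → j ≤ d′ → g₂ (j * 2) ≡ 2 * g j + 1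
  values-double-even {j} j≤d′ = trans (cong g₂ (trans (*-comm j 2) (sym (+-identityʳ (2 * j))))) (values-double j≤d′ zero)

  values-double-odd : ∀ {j} → j ≤ d′ → g₂ (suc (j * 2)) ≡ 2 * g j
  values-double-odd {j} j≤d′ = trans (cong g₂ (trans (cong suc (*-comm j 2)) (+-comm 1 (2 * j))))
    (trans (values-double j≤d′ (suc zero)) (+-identityʳ (2 * g j)))

  -- A pair is mapped in reversed order, which is a descent.
  asc-double-pair : ∀ {j} → j ≤ d′ → asc g₂ (suc (j * 2)) ≡ asc g₂ (j * 2)
  asc-double-pair {j} j≤d′ = trans (cong (asc g₂ (j * 2) +_) (isAscent-≮ g₂ (j * 2) ≮)) (+-identityʳ _)
    where
    ≮ : ¬ (g₂ (j * 2) < g₂ (suc (j * 2)))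
    ≮ rewrite values-double-even j≤d′ | values-double-odd j≤d′ = ≤⇒≯ (m≤m+n (2 * g j) 1)

  -- Between neighbouring pairs, `2 * g j` is compared with `2 * g (suc j) + 1`; the added one
  -- changes nothing, as the two values of `g` differ.
  isAscent-double : IsPerm ρ → ∀ {j} → j < d′ → isAscent g₂ (suc (j * 2)) ≡ isAscent g j
  isAscent-double perm {j} j<d′ with g j <? g (suc j)
  ... | yes lt = trans (isAscent-< g₂ (suc (j * 2)) lt₂) (sym (isAscent-< g j lt))
    where
    lt₂ : g₂ (suc (j * 2)) < g₂ (suc j * 2)
    lt₂ rewrite values-double-odd (<⇒≤ j<d′) | values-double-even j<d′ =
      ≤-trans (*-monoʳ-< 2 lt) (m≤m+n _ 1)
  ... | no ≮ = trans (isAscent-≮ g₂ (suc (j * 2)) ≮₂) (sym (isAscent-≮ g j ≮))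
    where
    gt : g (suc j) < g j
    gt = ≤∧≢⇒< (≮⇒≥ ≮) (λ eq → values-distinct {τ = ρ} perm j j<d′ (sym eq))
    ≮₂ : ¬ (g₂ (suc (j * 2)) < g₂ (suc j * 2))
    ≮₂ rewrite values-double-odd (<⇒≤ j<d′) | values-double-even j<d′ =
      ≤⇒≯ (≤-trans (≤-reflexive (+-comm _ 1)) (*-monoʳ-< 2 gt))

  asc-double : IsPerm ρ → ∀ {j} → j ≤ d′ → asc g₂ (j * 2) ≡ asc g j
  asc-double perm {zero}  _    = refl
  asc-double perm {suc j} j<d′ = cong₂ _+_
    (trans (asc-double-pair (<⇒≤ j<d′)) (asc-double perm (<⇒≤ j<d′))) (isAscent-double perm j<d′)

  ascents-double : IsPerm ρ → ascents (double ρ) ≡ ascents ρ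
  ascents-double perm = begin
    ascents (double ρ)      ≡⟨ ascents≡asc (double ρ) ⟩
    asc g₂ (suc (d′ * 2))   ≡⟨ asc-double-pair ≤-refl ⟩
    asc g₂ (d′ * 2)         ≡⟨ asc-double perm ≤-refl ⟩
    asc g d′                ≡⟨ ascents≡asc ρ ⟨
    ascents ρ               ∎
    where open ≡-Reasoning

  -- No ascent lies inside a pair. With `iter-double-odd`, this makes the canonical word repeat
  -- after half its length.
  ascBefore-double : ∀ q r → ascBefore (double ρ) (combine q r) ≡ ascBefore (double ρ) (combine q (opposite r))
  ascBefore-double q = λ { zero → sym pair ; (suc zero) → pair }
    where
    pair : ascBefore (double ρ) (combine q (suc zero)) ≡ ascBefore (double ρ) (combine q zero)
    pair = trans (cong (asc g₂) (toℕ-pair₁ q)) (trans (asc-double-pair (toℕ≤pred[n] q)) (cong (asc g₂) (sym (toℕ-pair₀ q))))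

-- Cycles with a repeated word

module Unfold {d′ : ℕ} {τ : Vec (Fin (suc d′ * 2)) (suc d′ * 2)} {ℓ : Fin (suc d′ * 2) → ℕ}
  (cyc : IsNCycle τ) (seg : Segmentation τ ℓ)
  (x₀ y₀ : Fin (suc d′ * 2)) (same₀ : SameWord τ ℓ x₀ y₀) (x₀≢y₀ : x₀ ≢ y₀) where

  open Segmentation seg

  d : ℕ
  d = suc d′

  σ : Fin (d * 2) → Fin (d * 2)
  σ = iter τ d

  -- The exponent leading from `x` to `y` can be taken below `d * 2`; its double is a period, so it
  -- is 0 or `d`.
  partner : ∀ {x y} → SameWord τ ℓ x y → x ≢ y → y ≡ σ x
  partner {x} {y} same x≢y with e , refl ← reach cyc x y
    with doubled-period cyc (toℕ<n e) (SameWord-period seg cyc {toℕ e} same)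
  ... | inj₁ e≡0  = contradiction (cong (λ m → iter τ m x) (sym e≡0)) x≢y
  ... | inj₂ 2e≡n = cong (λ m → iter τ m x) (*-cancelʳ-≡ (toℕ e) d 2
          (trans (*-comm (toℕ e) 2) (trans (cong (toℕ e +_) (+-identityʳ (toℕ e))) 2e≡n)))

  σ-involutive : ∀ x → σ (σ x) ≡ x
  σ-involutive x = trans (sym (iter-+ τ d d x))
    (trans (cong (λ m → iter τ m x) (trans (cong (d +_) (sym (+-identityʳ d))) (*-comm 2 d))) (iter-n cyc x))

  -- The word of any point is a tail of the word of `x₀`, so the one given coincidence is carried
  -- round the whole cycle.
  σ-same : ∀ x → SameWord τ ℓ x (σ x)
  σ-same x j with m , refl ← proj₂ cyc x₀ x = begin
    ℓ (iter τ j (iter τ m x₀))      ≡⟨ cong ℓ (iter-+ τ j m x₀) ⟨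
    ℓ (iter τ (j + m) x₀)           ≡⟨ same₀ (j + m) ⟩
    ℓ (iter τ (j + m) y₀)           ≡⟨ cong (λ y → ℓ (iter τ (j + m) y)) (partner same₀ x₀≢y₀) ⟩
    ℓ (iter τ (j + m) (σ x₀))       ≡⟨ cong ℓ (iter-+ τ j m (σ x₀)) ⟩
    ℓ (iter τ j (iter τ m (σ x₀)))  ≡⟨ cong (λ y → ℓ (iter τ j y)) (iter-comm τ m d x₀) ⟩
    ℓ (iter τ j (σ (iter τ m x₀)))  ∎
    where open ≡-Reasoning

  σ-fixpoint-free : ∀ x → σ x ≢ x
  σ-fixpoint-free x eq = <⇒≱ (m<m*n d 2 (s≤s (s≤s z≤n))) (period≥n cyc z<s eq)

  sandwich : ∀ j {a b c} → Alt F._<_ j a b → Alt F._<_ j b c → ℓ a ≡ ℓ c → ℓ a ≡ ℓ b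
  sandwich zero    a<b b<c eq = ≤-antisym (mono a<b) (≤-trans (mono b<c) (≤-reflexive (sym eq)))
  sandwich (suc j) r   r′  eq = trans eq (sandwich j r′ r (sym eq))

  -- While the letters agree, the images of `y` stay between those of `x` and `σ x`, in one
  -- direction or the other, and `sandwich` squeezes the next letter.
  between-prefix : ∀ {x y} → x F.< y → y F.< σ x → ∀ j m → m < j → ℓ (iter τ m x) ≡ ℓ (iter τ m y)
  between-prefix {x} {y} x<y y<σx (suc j) m (s≤s m≤j) with m≤n⇒m<n∨m≡n m≤j
  ... | inj₁ m<j  = between-prefix x<y y<σx j m m<j
  ... | inj₂ refl = sandwich j (iter-Alt seg j pre x<y)
          (iter-Alt seg j (λ i i<j → trans (sym (pre i i<j)) (σ-same x i)) y<σx) (σ-same x j)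
    where
    pre : ∀ i → i < j → ℓ (iter τ i x) ≡ ℓ (iter τ i y)
    pre = between-prefix x<y y<σx j

  -- A rank strictly between would share the word of `x` and so be a second partner.
  σ-adjacent : ∀ {x} → x F.< σ x → toℕ (σ x) ≡ suc (toℕ x)
  σ-adjacent {x} x<σx with m≤n⇒m<n∨m≡n x<σx
  ... | inj₂ eq   = sym eq
  ... | inj₁ 1+x< = contradiction (partner (λ j → between-prefix x<y y<σx (suc j) j ≤-refl) (F.<⇒≢ x<y)) (F.<⇒≢ y<σx)
    where
    1+x<n : suc (toℕ x) < d * 2
    1+x<n = <-trans 1+x< (toℕ<n (σ x))
    x<y : x F.< F.fromℕ< 1+x<n
    x<y = ≤-reflexive (sym (toℕ-fromℕ< 1+x<n))
    y<σx : F.fromℕ< 1+x<n F.< σ x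
    y<σx = subst (_< toℕ (σ x)) (sym (toℕ-fromℕ< 1+x<n)) 1+x<

  -- Induction from the bottom: if rank `2j + 2` were the upper member of its pair, its partner
  -- would be `2j + 1`, already taken by `2j`.
  σ-even : ∀ j x → toℕ x ≡ j * 2 → toℕ (σ x) ≡ suc (j * 2)
  σ-even j x eq with F.<-cmp x (σ x)
  σ-even j x eq       | tri< x<σx _ _ = trans (σ-adjacent x<σx) (cong suc eq)
  σ-even j x eq       | tri≈ _ x≡σx _ = contradiction (sym x≡σx) (σ-fixpoint-free x)
  σ-even zero x eq    | tri> _ _ σx<x = contradiction (subst (toℕ (σ x) <_) eq σx<x) (λ ())
  σ-even (suc j) x eq | tri> _ _ σx<x = contradiction (iter-injective {τ = τ} (proj₁ cyc) d (toℕ-injective (trans σx≡ (sym σz≡)))) x≢z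
    where
    j*2<n : j * 2 < d * 2
    j*2<n = <-trans (≤-trans (n<1+n (j * 2)) (n≤1+n _)) (subst (_< d * 2) eq (toℕ<n x))
    z : Fin (d * 2)
    z = F.fromℕ< j*2<n
    σz≡ : toℕ (σ z) ≡ suc (j * 2)
    σz≡ = σ-even j z (toℕ-fromℕ< j*2<n)
    σx≡ : toℕ (σ x) ≡ suc (j * 2)
    σx≡ = suc-injective (trans (sym (σ-adjacent (subst (σ x F.<_) (sym (σ-involutive x)) σx<x))) (trans (cong toℕ (σ-involutive x)) eq))
    x≢z : x ≢ z
    x≢z x≡z = m≢1+n+m (j * 2) (trans (sym (toℕ-fromℕ< j*2<n)) (trans (cong toℕ (sym x≡z)) eq))

  σ-combine₀ : ∀ (q : Fin d) → σ (combine q zero) ≡ combine q (suc zero)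
  σ-combine₀ q = toℕ-injective (trans (σ-even (toℕ q) (combine q zero) (toℕ-pair₀ q)) (sym (toℕ-pair₁ q)))

  σ-combine : ∀ (q : Fin d) (r : Fin 2) → σ (combine q r) ≡ combine q (opposite r)
  σ-combine q zero       = σ-combine₀ q
  σ-combine q (suc zero) = trans (cong σ (sym (σ-combine₀ q))) (σ-involutive (combine q zero))

  τσ : ∀ x → lookup τ (σ x) ≡ σ (lookup τ x)
  τσ x = iter-comm τ 1 d x

  quotient : Fin d → Fin d
  quotient q = proj₁ (remQuot {d} 2 (lookup τ (combine q zero)))

  ρ : Vec (Fin d) d
  ρ = tabulate quotient


  -- The two ranks of a pair share a letter, so `τ` reverses them; as `τ` commutes with `σ`, the
  -- images form a pair again, and the lower rank goes to the upper one.
  τ-combine₀ : ∀ (q : Fin d) → lookup τ (combine q zero) ≡ combine (lookup ρ q) (suc zero)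
  τ-combine₀ q = trans (sym (combine-remQuot {d} 2 y)) (cong₂ combine (sym (lookup∘tabulate quotient q)) (upper (proj₂ (remQuot {d} 2 y)) refl))
    where
    y : Fin (d * 2)
    y = lookup τ (combine q zero)
    a : Fin d
    a = proj₁ (remQuot {d} 2 y)
    σy<y : σ y F.< y
    σy<y = subst (F._< y) (trans (cong (lookup τ) (sym (σ-combine₀ q))) (τσ (combine q zero)))
      (anti (pair-< q) (trans (σ-same (combine q zero) 0) (cong ℓ (σ-combine₀ q))))
    upper : ∀ r → proj₂ (remQuot {d} 2 y) ≡ r → r ≡ suc zero
    upper (suc zero) _  = refl
    upper zero       eq = contradiction (subst₂ F._<_ (trans (cong σ y≡) (σ-combine₀ a)) y≡ σy<y) (<-asym (pair-< a))
      where
      y≡ : y ≡ combine a zero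
      y≡ = trans (sym (combine-remQuot {d} 2 y)) (cong (combine a) eq)

  τ-combine : ∀ (q : Fin d) (r : Fin 2) → lookup τ (combine q r) ≡ combine (lookup ρ q) (opposite r)
  τ-combine q zero       = τ-combine₀ q
  τ-combine q (suc zero) = begin
    lookup τ (combine q (suc zero))   ≡⟨ cong (lookup τ) (σ-combine₀ q) ⟨
    lookup τ (σ (combine q zero))     ≡⟨ τσ (combine q zero) ⟩
    σ (lookup τ (combine q zero))     ≡⟨ cong σ (τ-combine₀ q) ⟩
    σ (combine (lookup ρ q) (suc zero)) ≡⟨ σ-combine (lookup ρ q) (suc zero) ⟩
    combine (lookup ρ q) zero         ∎
    where open ≡-Reasoning

  τ≡double : τ ≡ double ρ
  τ≡double = lookup-ext pointwise
    where
    pointwise : ∀ y → lookup τ y ≡ lookup (double ρ) y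
    pointwise y with q , r , refl ← combine-surjective {d} y = trans (τ-combine q r) (sym (lookup-double ρ q r))

-- The cycle of a pattern

perm-surjective : ∀ {n} (π : Vec (Fin n) n) → IsPerm π → ∀ y → ∃[ i ] lookup π i ≡ y
perm-surjective {suc n} π perm y with F.any? (λ i → lookup π i F.≟ y)
... | yes hit  = hit
... | no  miss = contradiction (injective⇒≤ {f = λ i → punchOut (y≢ i)}
      (λ {i} {j} eq → perm i j (punchOut-injective (y≢ i) (y≢ j) eq))) 1+n≰n
  where
  y≢ : ∀ i → y ≢ lookup π i
  y≢ i eq = miss (i , sym eq)

mod-+ : ∀ n a m → (toℕ (a mod suc n) + m) mod suc n ≡ (a + m) mod suc n
mod-+ n a m = toℕ-injective (begin
  toℕ ((toℕ (a mod suc n) + m) mod suc n)          ≡⟨ toℕ-fromℕ< (m%n<n (toℕ (a mod suc n) + m) (suc n)) ⟩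
  (toℕ (a mod suc n) + m) % suc n                  ≡⟨ cong (λ r → (r + m) % suc n) (toℕ-fromℕ< (m%n<n a (suc n))) ⟩
  (a % suc n + m) % suc n                          ≡⟨ %-distribˡ-+ (a % suc n) m (suc n) ⟩
  (a % suc n % suc n + m % suc n) % suc n          ≡⟨ cong (λ r → (r + m % suc n) % suc n) (m%n%n≡m%n a (suc n)) ⟩
  (a % suc n + m % suc n) % suc n                  ≡⟨ %-distribˡ-+ a m (suc n) ⟨
  (a + m) % suc n                                  ≡⟨ toℕ-fromℕ< (m%n<n (a + m) (suc n)) ⟨
  toℕ ((a + m) mod suc n)                          ∎)
  where open ≡-Reasoning

-- The cycle (π₁ π₂ … πₙ).
module Hat {n : ℕ} (π : Vec (Fin (suc n)) (suc n)) (perm : IsPerm π) where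

  inv : Fin (suc n) → Fin (suc n)
  inv y = proj₁ (perm-surjective π perm y)

  π-inv : ∀ y → lookup π (inv y) ≡ y
  π-inv y = proj₂ (perm-surjective π perm y)

  inv-π : ∀ i → inv (lookup π i) ≡ i
  inv-π i = perm _ _ (π-inv (lookup π i))

  next : Fin (suc n) → Fin (suc n)
  next i = suc (toℕ i) mod suc n

  hat : Vec (Fin (suc n)) (suc n)
  hat = tabulate (λ y → lookup π (next (inv y)))

  lookup-hat : ∀ y → lookup hat y ≡ lookup π (next (inv y))
  lookup-hat = lookup∘tabulate (λ y → lookup π (next (inv y)))

  -- The one-line notation continued periodically, so that `hat` acts by shifting the index.
  at : ℕ → Fin (suc n)
  at m = lookup π (m mod suc n)

  at-toℕ : ∀ i → at (toℕ i) ≡ lookup π i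
  at-toℕ i = cong (lookup π) (mod-toℕ i)

  at-period : ∀ m → at (m + suc n) ≡ at m
  at-period m = cong (lookup π) (toℕ-injective (begin
    toℕ ((m + suc n) mod suc n) ≡⟨ toℕ-fromℕ< (m%n<n (m + suc n) (suc n)) ⟩
    (m + suc n) % suc n         ≡⟨ [m+n]%n≡m%n m (suc n) ⟩
    m % suc n                   ≡⟨ toℕ-fromℕ< (m%n<n m (suc n)) ⟨
    toℕ (m mod suc n)           ∎))
    where open ≡-Reasoning

  hat-at : ∀ m → lookup hat (at m) ≡ at (suc m)
  hat-at m = begin
    lookup hat (at m)                     ≡⟨ lookup-hat (at m) ⟩
    lookup π (next (inv (at m)))          ≡⟨ cong (λ i → lookup π (next i)) (inv-π (m mod suc n)) ⟩
    lookup π (suc (toℕ (m mod suc n)) mod suc n) ≡⟨ cong (λ j → lookup π (j mod suc n)) (+-comm 1 (toℕ (m mod suc n))) ⟩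
    lookup π ((toℕ (m mod suc n) + 1) mod suc n) ≡⟨ cong (lookup π) (mod-+ n m 1) ⟩
    at (m + 1)                            ≡⟨ cong at (+-comm m 1) ⟩
    at (suc m)                            ∎
    where open ≡-Reasoning

  iter-hat : ∀ m a → iter hat m (at a) ≡ at (m + a)
  iter-hat zero    a = refl
  iter-hat (suc m) a = trans (cong (lookup hat) (iter-hat m a)) (hat-at (m + a))

  at-surjective : ∀ x → ∃[ i ] at (toℕ {suc n} i) ≡ x
  at-surjective x = inv x , trans (at-toℕ (inv x)) (π-inv x)

  iter-hat-n : ∀ x → iter hat (suc n) x ≡ x
  iter-hat-n x with i , refl ← at-surjective x =
    trans (iter-hat (suc n) (toℕ i)) (trans (cong at (+-comm (suc n) (toℕ i))) (at-period (toℕ i)))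

  hat-isNCycle : IsNCycle hat
  hat-isNCycle = injective , connected
    where
    -- The cycle length is `suc n`, so `iter hat n` inverts `hat`.
    round : ∀ x → iter hat n (lookup hat x) ≡ x
    round x = trans (iter-comm hat n 1 x) (iter-hat-n x)
    injective : IsPerm hat
    injective x y eq = trans (sym (round x)) (trans (cong (iter hat n) eq) (round y))
    connected : ∀ x y → ∃[ m ] iter hat m x ≡ y
    connected x y with i , refl ← at-surjective x | j , refl ← at-surjective y =
      -- From index `i` go forward to the end of the period and then on to `j`, whichever of the two
      -- is larger.
      toℕ j + (suc n ∸ toℕ i) , (begin
      iter hat (toℕ j + (suc n ∸ toℕ i)) (at (toℕ i)) ≡⟨ iter-hat (toℕ j + (suc n ∸ toℕ i)) (toℕ i) ⟩
      at (toℕ j + (suc n ∸ toℕ i) + toℕ i)            ≡⟨ cong at (+-assoc (toℕ j) _ (toℕ i)) ⟩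
      at (toℕ j + (suc n ∸ toℕ i + toℕ i))            ≡⟨ cong (λ m → at (toℕ j + m)) (m∸n+n≡m (<⇒≤ (toℕ<n i))) ⟩
      at (toℕ j + suc n)                              ≡⟨ at-period (toℕ j) ⟩
      at (toℕ j)                                      ∎)
      where open ≡-Reasoning

  orbit-hat : π ≡ orbit hat (at 0)
  orbit-hat = lookup-ext (λ i → sym (trans (lookup-orbit hat (at 0) i)
    (trans (iter-hat (toℕ i) 0) (trans (cong at (+-identityʳ (toℕ i))) (at-toℕ i)))))

module PatternLabels {n k : ℕ} (π : Vec (Fin (suc n)) (suc n)) (perm : IsPerm π)
  (s : Vec (Fin k) (suc n)) (isPattern : IsPattern allMinus s π) where

  open Hat π perm public

  W : Fin (suc n) → Word k
  W i = shiftBy (toℕ i) (periodic s)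

  W-zero : ∀ i → W i 0 ≡ lookup s i
  W-zero i = trans (cong (λ m → lookup s (m mod suc n)) (+-identityʳ (toℕ i))) (cong (lookup s) (mod-toℕ i))

  W-next : ∀ i m → W (next i) m ≡ W i (suc m)
  W-next i m = cong (lookup s) (trans (mod-+ n (suc (toℕ i)) m) (cong (_mod suc n) (sym (+-suc (toℕ i) m))))

  label : Fin (suc n) → ℕ
  label x = toℕ (lookup s (inv x))

  label-at : ∀ i → label (at (toℕ i)) ≡ toℕ (lookup s i)
  label-at i = cong (λ j → toℕ (lookup s j)) (trans (cong inv (at-toℕ i)) (inv-π i))

  -- Deleting the first letter of two words that share it reverses their order.
  segmentation : Segmentation hat label
  segmentation = record { mono = mono ; anti = anti }
    where
    order : ∀ {x y} → x F.< y → ∃[ j ] ((∀ m → m < j → W (inv x) m ≡ W (inv y) m) × Alt F._<_ j (W (inv x) j) (W (inv y) j))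
    order {x} {y} x<y = to (≺⇔Alt (W (inv x)) (W (inv y)))
      (to (isPattern (inv x) (inv y)) (subst₂ F._<_ (sym (π-inv x)) (sym (π-inv y)) x<y))
    mono : ∀ {x y} → x F.< y → label x ≤ label y
    mono {x} {y} x<y with order x<y
    ... | zero  , pre , r = <⇒≤ (subst₂ F._<_ (W-zero (inv x)) (W-zero (inv y)) r)
    ... | suc j , pre , r = ≤-reflexive (cong toℕ (trans (sym (W-zero (inv x))) (trans (pre 0 z<s) (W-zero (inv y)))))
    anti : ∀ {x y} → x F.< y → label x ≡ label y → lookup hat y F.< lookup hat x
    anti {x} {y} x<y eq with order x<y
    ... | zero  , pre , r = contradiction (subst₂ F._<_ (W-zero (inv x)) (W-zero (inv y)) r) (<-irrefl eq)
    ... | suc j , pre , r = subst₂ F._<_ (sym (lookup-hat y)) (sym (lookup-hat x))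
      (from (isPattern (next (inv y)) (next (inv x))) (from (≺⇔Alt (W (next (inv y))) (W (next (inv x))))
        (j , (λ m m<j → trans (W-next (inv y) m) (trans (sym (pre (suc m) (s≤s m<j))) (sym (W-next (inv x) m)))) ,
         subst₂ (Alt F._<_ j) (sym (W-next (inv y) j)) (sym (W-next (inv x) j)) r)))

  -- Applying `hat` moves one place along the word, so labels invariant under `iter hat e` would
  -- make `s` a repeated block of length `e`.
  label-aperiodic : Primitive s → ∀ e → 0 < e → e < suc n → e ∣ suc n → ¬ (∀ x → label x ≡ label (iter hat e x))
  label-aperiodic prim e 0<e e<n e∣n per = prim e 0<e e<n e∣n (λ i j j≡i+e → toℕ-injective (begin
    toℕ (lookup s i)                    ≡⟨ label-at i ⟨
    label (at (toℕ i))                  ≡⟨ per (at (toℕ i)) ⟩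
    label (iter hat e (at (toℕ i)))     ≡⟨ cong label (iter-hat e (toℕ i)) ⟩
    label (at (e + toℕ i))              ≡⟨ cong (λ m → label (at m)) (trans (+-comm e (toℕ i)) (sym j≡i+e)) ⟩
    label (at (toℕ j))                  ≡⟨ label-at j ⟩
    toℕ (lookup s j)                    ∎))
    where open ≡-Reasoning

-- Realisable cycles and the count

no-decreasing-cycle : ∀ {n} {τ : Vec (Fin (suc n)) (suc n)} → 3 ≤ suc n → IsNCycle τ → ascents τ ≢ 0
-- Without ascents all canonical labels are 0, so rank 0 and its image share a word; then 2 is a
-- period, and the length is at most 2.
no-decreasing-cycle {n} {τ} 3≤n cyc asc≡0 = <⇒≱ 3≤n
  (period≥n cyc z<s (SameWord-period (canonical {τ = τ} (proj₁ cyc)) cyc {1} {zero}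
    (λ j → trans (flat (iter τ j zero)) (sym (flat (iter τ j (iter τ 1 zero)))))))
  where
  flat : ∀ x → ascBefore τ x ≡ 0
  flat x = n≤0⇒n≡0 (subst (ascBefore τ x ≤_) asc≡0 (ascBefore≤ascents τ x))

-- The letter 0 marks rank 0 alone and every orbit passes it; points with equal words reach it at
-- the same time, and powers of `τ` are injective.
marked-separates : ∀ {n} {τ : Vec (Fin (suc n)) (suc n)} → IsNCycle τ → ∀ x y → SameWord τ (markedLabel τ) x y → x ≡ y
marked-separates {n} {τ} (perm , conn) x y same with m , eq ← conn x zero =
  iter-injective {τ = τ} perm m (trans eq (sym (label-zero (iter τ m y) (trans (sym (same m)) (cong (markedLabel τ) eq)))))
  where
  label-zero : ∀ z → markedLabel τ z ≡ 0 → z ≡ zero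
  label-zero zero _ = refl

module _ (c k : ℕ) where
  private
    d : ℕ
    d = suc (c * 2)

  Doubled : Vec (Fin (d * 2)) (d * 2) → Set
  Doubled τ = ∃[ ρ ] (CycAsc d k ρ × τ ≡ double ρ)

  -- The cycles that come from patterns, as the next lemmas show. Only doublings with exactly
  -- `k - 1` ascents are excluded, since with fewer the cuts are not forced.
  Realisable : Vec (Fin (d * 2)) (d * 2) → Set
  Realisable τ = IsNCycle τ × ascents τ + 1 ≤ k × ¬ Doubled τ

  Doubled⇒CycAsc : ∀ {τ} → Doubled τ → CycAsc (d * 2) k τ
  Doubled⇒CycAsc (ρ , (cyc , asc≡) , refl) = double-cycle c cyc , trans (cong (_+ 1) (ascents-double ρ (proj₁ cyc))) asc≡

  Realisable⇒InPatterns : ∀ {τ} → Realisable τ → ∀ (x : Fin (d * 2)) → InPatterns (d * 2) k allMinus (orbit τ x)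
  Realisable⇒InPatterns {τ} (cyc , asc≤ , ¬doubled) with m≤n⇒m<n∨m≡n asc≤
  -- A letter remains to spare, so rank 0 can have one of its own.
  ... | inj₁ asc<k = realise cyc (marked {τ = τ} (proj₁ cyc)) bound (marked-separates cyc)
    where
    bound : ∀ (x : Fin (d * 2)) → markedLabel τ x < k
    bound zero      = ≤-trans (s≤s z≤n) asc<k
    bound x@(suc _) = ≤-trans (s≤s (≤-trans (s≤s (ascBefore≤ascents τ x)) (≤-reflexive (+-comm 1 (ascents τ))))) asc<k
  ... | inj₂ asc≡k = realise cyc (canonical {τ = τ} (proj₁ cyc)) bound separates
    where
    bound : ∀ (x : Fin (d * 2)) → ascBefore τ x < k
    bound x = ≤-trans (s≤s (ascBefore≤ascents τ x)) (≤-reflexive (trans (+-comm 1 (ascents τ)) asc≡k))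
    separates : ∀ (x y : Fin (d * 2)) → SameWord τ (ascBefore τ) x y → x ≡ y
    separates x y same with x F.≟ y
    ... | yes x≡y = x≡y
    ... | no  x≢y = contradiction (ρ , (cycρ , trans (cong (_+ 1) asc≡) asc≡k) , τ≡double) ¬doubled
      where
      open Unfold {c * 2} {τ} {ascBefore τ} cyc (canonical {τ = τ} (proj₁ cyc)) x y same x≢y using (ρ; τ≡double)
      cycρ : IsNCycle ρ
      cycρ = double-cycle⁻ (subst IsNCycle τ≡double cyc)
      asc≡ : ascents ρ ≡ ascents τ
      asc≡ = trans (sym (ascents-double ρ (proj₁ cycρ))) (cong ascents (sym τ≡double))

  -- Having only `k` letters bounds the ascents. For an excluded doubling, `tight-label` would force
  -- the canonical letters, whose period `d` contradicts primitivity.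
  InPatterns⇒Realisable : ∀ {π} → InPatterns (d * 2) k allMinus π → ∃[ τ ] ∃[ x ] (Realisable τ × π ≡ orbit τ x)
  InPatterns⇒Realisable {π} (perm , s , prim , isPattern) =
    hat , at 0 , (hat-isNCycle , ascents≤label segmentation label<k , ¬doubled) , orbit-hat
    where
    open PatternLabels π perm s isPattern
    label<k : ∀ x → label x < k
    label<k x = toℕ<n (lookup s (inv x))
    ¬doubled : ¬ Doubled hat
    ¬doubled dbl@(ρ , (cycρ , _) , hat≡) =
      label-aperiodic prim d z<s (m<m*n d 2 (s≤s (s≤s z≤n))) (m∣m*n 2)
        (λ x → trans (label≡ x) (trans (periodic-asc x) (sym (label≡ (iter hat d x)))))
      where
      label≡ : ∀ x → label x ≡ ascBefore hat x
      label≡ = tight-label segmentation label<k (proj₂ (Doubled⇒CycAsc dbl))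
      periodic-asc : ∀ x → ascBefore hat x ≡ ascBefore hat (iter hat d x)
      periodic-asc x = subst (λ τ → ascBefore τ x ≡ ascBefore τ (iter τ d x)) (sym hat≡) (on-double x)
        where
        on-double : ∀ x → ascBefore (double ρ) x ≡ ascBefore (double ρ) (iter (double ρ) d x)
        on-double x with q , r , refl ← combine-surjective {d} x =
          trans (ascBefore-double ρ q r) (cong (ascBefore (double ρ)) (sym (iter-double-odd c cycρ q r)))

CycAsc? : ∀ {n} i (τ : Vec (Fin (suc n)) (suc n)) → Dec (CycAsc (suc n) i τ)
CycAsc? i τ = IsNCycle? τ ×-dec (ascents τ + 1 ≟ i)

-- Realisable cycles and doublings together are the cycles with 1 to `k - 1` ascents, and each
-- realisable cycle yields one pattern for each of its `n` starting points.
pattern-count : (c k : ℕ) → let d = suc (c * 2); n = d * 2 in 3 ≤ n → 3 ≤ k →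
  ∃[ m ] (HasSize (InPatterns n k allMinus) m ×
  ∃[ c₀ ] (HasSize (CycAsc d k) c₀ ×
  ∃[ a ] ((∀ i → 2 ≤ i → i ≤ k → HasSize (CycAsc n i) (a i)) ×
  m + n * c₀ ≡ n * sumFrom 2 (k ∸ 1) a)))
pattern-count c k 3≤n 3≤k =
  g * n , patternsSize , c₀ , sizeCyc₀ , a , (λ i _ _ → sizeCyc i) , equation
  where
  d n : ℕ
  d = suc (c * 2)
  n = d * 2
  a : ℕ → ℕ
  a i = proj₁ (HasSize-filter (HasSize-Vec n n) (CycAsc? i))
  sizeCyc : ∀ i → HasSize (CycAsc n i) (a i)
  sizeCyc i = proj₂ (HasSize-filter (HasSize-Vec n n) (CycAsc? i))
  c₀ : ℕ
  c₀ = proj₁ (HasSize-filter (HasSize-Vec d d) (CycAsc? k))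
  sizeCyc₀ : HasSize (CycAsc d k) c₀
  sizeCyc₀ = proj₂ (HasSize-filter (HasSize-Vec d d) (CycAsc? k))
  doubledSize : HasSize (Doubled c k) c₀
  doubledSize = HasSize-image double (λ _ _ → double-injective) sizeCyc₀
  realisable : ∃[ g ] HasSize (Realisable c k) g
  realisable = HasSize-filter (HasSize-Vec n n) (λ τ →
    IsNCycle? τ ×-dec ((ascents τ + 1 ≤? k) ×-dec ¬? (HasSize-dec (≡-dec F._≟_) doubledSize τ)))
  g : ℕ
  g = proj₁ realisable
  patternsSize : HasSize (InPatterns n k allMinus) (g * n)
  patternsSize = HasSize-resp
    (λ π → mk⇔ (λ { ((τ , x) , r , refl) → Realisable⇒InPatterns c k r x })
               (λ p → let τ , x , r , eq = InPatterns⇒Realisable c k p in (τ , x) , r , eq))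
    (HasSize-image (λ (τ , x) → orbit τ x)
      (λ r r′ eq → let τ≡ , x≡ = orbit-injective (proj₁ r) (proj₁ r′) eq in cong₂ _,_ τ≡ x≡)
      (HasSize-×Fin n (proj₂ realisable)))
  -- The `k - 1` summands starting at index 2 end at index `k`.
  2+[k∸1]≡1+k : 2 + (k ∸ 1) ≡ suc k
  2+[k∸1]≡1+k = cong suc (m+[n∸m]≡n (≤-trans (s≤s z≤n) 3≤k))
  InRange : Vec (Fin n) n → Set
  InRange τ = IsNCycle τ × 2 ≤ ascents τ + 1 × ascents τ + 1 < 2 + (k ∸ 1)
  split : ∀ τ → (Realisable c k τ ⊎ Doubled c k τ) ⇔ InRange τ
  split τ = mk⇔ fwd bwd
    where
    <2+ : ascents τ + 1 ≤ k → ascents τ + 1 < 2 + (k ∸ 1)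
    <2+ p = subst (ascents τ + 1 <_) (sym 2+[k∸1]≡1+k) (s≤s p)
    fwd : Realisable c k τ ⊎ Doubled c k τ → InRange τ
    -- Starting the sum at 2 loses nothing: a cycle of length at least 3 has an ascent.
    fwd (inj₁ (cyc , asc≤ , _)) = cyc , +-monoˡ-≤ 1 (n≢0⇒n>0 (no-decreasing-cycle 3≤n cyc)) , <2+ asc≤
    fwd (inj₂ dbl) = let cyc , asc≡ = Doubled⇒CycAsc c k dbl in
      cyc , subst (2 ≤_) (sym asc≡) (≤-trans (n≤1+n 2) 3≤k) , <2+ (≤-reflexive asc≡)
    bwd : InRange τ → Realisable c k τ ⊎ Doubled c k τ
    bwd (cyc , _ , asc<) = decide (HasSize-dec (≡-dec F._≟_) doubledSize τ)
      where
      decide : Dec (Doubled c k τ) → Realisable c k τ ⊎ Doubled c k τ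
      decide (yes dbl) = inj₂ dbl
      decide (no ¬dbl) = inj₁ (cyc , s≤s⁻¹ (subst (ascents τ + 1 <_) 2+[k∸1]≡1+k asc<) , ¬dbl)
  total : g + c₀ ≡ sumFrom 2 (k ∸ 1) a
  total = HasSize-functional
    (HasSize-resp split (HasSize-⊎ (λ τ (_ , _ , ¬dbl) dbl → ¬dbl dbl) (proj₂ realisable) doubledSize))
    (HasSize-sumFrom IsNCycle (λ τ → ascents τ + 1) a sizeCyc 2 (k ∸ 1))
  equation : g * n + n * c₀ ≡ n * sumFrom 2 (k ∸ 1) a
  equation = trans (cong (_+ n * c₀) (*-comm g n)) (trans (sym (*-distribˡ-+ n g c₀)) (cong (n *_) total))

theorem3p16 : (n k : ℕ) → 3 ≤ n → n % 4 ≡ 2 → 3 ≤ k →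
    ∃[ m ] (HasSize (InPatterns n k allMinus) m ×
    ∃[ c₀ ] (HasSize (CycAsc (n / 2) k) c₀ ×
    ∃[ c ] ((∀ i → 2 ≤ i → i ≤ k → HasSize (CycAsc n i) (c i)) ×
    m + n * c₀ ≡ n * sumFrom 2 (k ∸ 1) c)))
theorem3p16 n k 3≤n n%4≡2 3≤k =
  subst Claim (sym n≡) (subst (ClaimWith (d * 2)) (sym (m*n/n≡m d 2))
    (pattern-count (n / 4) k (subst (3 ≤_) n≡ 3≤n) 3≤k))
  where
  d : ℕ
  d = suc (n / 4 * 2)
  -- Remainder 2 modulo 4 makes `n` twice an odd number; oddness is what `double-cycle` needs.
  n≡ : n ≡ d * 2
  n≡ = trans (m≡m%n+[m/n]*n n 4) (trans (cong (_+ n / 4 * 4) n%4≡2) (cong (2 +_) (sym (*-assoc (n / 4) 2 2))))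
  ClaimWith : ℕ → ℕ → Set
  ClaimWith n h = ∃[ m ] (HasSize (InPatterns n k allMinus) m ×
    ∃[ c₀ ] (HasSize (CycAsc h k) c₀ ×
    ∃[ c ] ((∀ i → 2 ≤ i → i ≤ k → HasSize (CycAsc n i) (c i)) ×
    m + n * c₀ ≡ n * sumFrom 2 (k ∸ 1) c)))
  Claim : ℕ → Set
  Claim n = ClaimWith n (n / 2)
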